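{- Let $c\geq 3$ be an integer and let $a$ be any residue modulo $c$. For a nonnegative integer $n$, let $\overline{N}(a,c,n)$ denote the number of overpartitions of $n$ whose rank is congruent to $a$ modulo $c$. Then \[ \overline{N}(a,c,n_1+n_2)<\overline{N}(a,c,n_1)\,\overline{N}(a,c,n_2) \] holds if $3\leq c\leq 5$ and $n_1,n_2\geq 9$, or if $c\geq 6$ and $n_1,n_2\geq M_c$, where \[ M_c=1.691\times 10^{13}\,c^{20}\exp\left(\frac{16c^2(2c^2+\pi)}{\pi^2}\right). \]
   Context: An overpartition of a nonnegative integer $n$ is a partition of $n$ (a non-increasing sequence of positive integers summing to $n$) in which the first occurrence of each distinct part may be overlined. For an overpartition $\lambda$, let $\ell(\lambda)$ be its largest part and $\#(\lambda)$ its number of parts; the rank of $\lambda$ (Lovejoy's overpartition rank) is $\mathrm{rank}(\lambda)=\ell(\lambda)-\#(\lambda)$. -}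

module Defs where

open import Data.Nat as ℕ using (ℕ; zero; suc; _+_; _*_; _∸_; _^_; _≤_; _≤?_; _⊔_)
open import Data.Nat.Base using (_!)
open import Data.Nat.Combinatorics using (_P_)
open import Data.Integer as ℤ using (ℤ; +_)
open import Data.Integer.Divisibility.Signed using (_∣_; _∣?_)
open import Data.List using (List; []; _∷_; _++_; map; concatMap; filter; length; replicate; upTo; foldr)
open import Data.Nat.ListAction using (sum)
open import Data.Bool using (Bool; true; false)
open import Data.Product using (_×_; _,_; proj₁; proj₂)

-- Overpartitions.
-- An overpartition is represented as a list of parts (value , overlined?)
-- in non-increasing order of value; only the first occurrence of each
-- distinct value may carry the flag 'true' (overlined).

OverPartition : Set
OverPartition = List (ℕ × Bool)

opsBounded : ℕ → ℕ → List OverPartition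
opsBounded zero zero    = [] ∷ []
opsBounded zero (suc _) = []
opsBounded (suc b) n =
  opsBounded b n ++
  concatMap
    (λ j → concatMap
       (λ ov → map
          (λ rest → ((suc b , ov) ∷ replicate j (suc b , false)) ++ rest)
          (opsBounded b (n ∸ (suc j * suc b))))
       (true ∷ false ∷ []))
    (filter (λ j → suc j * suc b ≤? n) (upTo (suc n)))

overpartitions : ℕ → List OverPartition
overpartitions n = opsBounded n n

largestPart : OverPartition → ℕ
largestPart λ′ = foldr (λ p m → proj₁ p ⊔ m) 0 λ′

numParts : OverPartition → ℕ
numParts = length

rank : OverPartition → ℤ
rank λ′ = (+ largestPart λ′) ℤ.- (+ numParts λ′)

Nbar : ℤ → ℕ → ℕ → ℕ
Nbar a c n = length (filter (λ λ′ → (+ c) ∣? (rank λ′ ℤ.- a)) (overpartitions n))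

-- The threshold  M_c = 1.691·10^13 · c^20 · exp(16c²(2c²+π)/π²).
--
-- Exact rational upper bounds for π (Leibniz partial sums ending in a
-- positive term):  p_m = Σ_{j<m} 8/((4j+1)(4j+3)) + 4/(4m+1)  ≥ π,
-- p_m → π.  Fractions are pairs (numerator , denominator), denominator > 0.

addFrac : ℕ × ℕ → ℕ × ℕ → ℕ × ℕ
addFrac (a , b) (c , d) = (a * d + c * b , b * d)

leibnizPairs : ℕ → ℕ × ℕ
leibnizPairs zero    = (0 , 1)
leibnizPairs (suc j) = addFrac (leibnizPairs j) (8 , (4 * j + 1) * (4 * j + 3))

piUpper : ℕ → ℕ × ℕ
piUpper m = addFrac (leibnizPairs m) (4 , 4 * m + 1)

-- With π ≤ P/Q, x_m = 16c²(2c²+P/Q)/(P/Q)² = A/B where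
-- A = 16c²·Q·(2c²Q + P), B = P²; x_m ≤ x := 16c²(2c²+π)/π², x_m → x.
-- Lower bound for M_c:  L_{m,k} = 1691·10^10·c^20·Σ_{i≤k} (A/B)^i / i!.
-- "L_{m,k} ≤ n", cleared of denominators (multiply by B^k·k!):
--   1691·10^10·c^20·Σ_{i≤k} A^i·B^(k∸i)·(k!/i!) ≤ n·B^k·k!,
-- where k!/i! = k P (k ∸ i).
lowerBoundLe : ℕ → ℕ → ℕ → ℕ → Set
lowerBoundLe c m k n =
  let Pn = proj₁ (piUpper m)
      Q = proj₂ (piUpper m)
      A = 16 * c ^ 2 * Q * (2 * c ^ 2 * Q + Pn)
      B = Pn ^ 2
  in 1691 * 10 ^ 10 * c ^ 20
       * sum (map (λ i → A ^ i * B ^ (k ∸ i) * (k P (k ∸ i))) (upTo (suc k)))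
     ≤ n * B ^ k * (k !)

-- n ≥ M_c  ⟺  n ≥ L_{m,k} for all m, k  (since sup_{m,k} L_{m,k} = M_c).
AtLeastM : ℕ → ℕ → Set
AtLeastM c n = ∀ m k → lowerBoundLe c m k n

{-# OPTIONS --safe #-}
-- Let P(n) be the number of overpartitions of n and N(a,n) the number of those with rank ≡ a (mod c).
-- Raising the largest part, adding a part 1, or adding a part 2 moves the rank by a known amount and is
-- injective, which gives P(n − e) ≤ c·N(a,n) ≤ P(n + e) for a small e, so it suffices to compare values
-- of P.  The logarithmic derivative of ∏(1 + qᵇ)/(1 − qᵇ) gives n·P(n) = Σ s(k)·P(n − k) with
-- 2k ≤ s(k) ≤ k(k + 1).  Comparing this recurrence term by term at y + e and at y turns an inequality
-- K·P(y + e) ≤ V·P(y) on a finite range into one for all larger y.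
-- For c ≤ 5 the finite ranges are checked by computation.  For c ≥ 6 the recurrence in the smaller of the
-- two variables multiplies the constant K in K·P(x + y) ≤ P(x)·P(y) by 4/3 at the price of multiplying
-- the range of validity by 64; M_c is large enough for 12c such steps.
module Submission where

open import Defs
open import Data.Nat
open import Data.Nat.Properties
open import Data.Nat.DivMod
open import Data.Nat.Induction using (<-rec)
import Data.Nat.Combinatorics as Combinatorics
import Data.Nat.Divisibility as ℕD
open import Data.Nat.ListAction using (sum)
open import Data.Nat.ListAction.Properties using (sum-++)
open import Data.Nat.Tactic.RingSolver using (solve-∀)
open import Data.Integer using (ℤ) renaming (+_ to pos)
import Data.Integer as ℤ
import Data.Integer.DivMod as ℤ
import Data.Integer.Properties as ℤ
import Data.Integer.Divisibility.Signed as ℤD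
import Data.Integer.Tactic.RingSolver as ℤ
open import Data.Bool using (Bool; true; false; if_then_else_; _∧_; T)
open import Data.Bool.Properties using (T-∧; T-≡)
open import Data.List
  using (List; []; _∷_; _++_; map; concatMap; filter; length; replicate; upTo; applyUpTo; take; drop; zipWith)
open import Data.List.Properties
  using (map-++; map-∘; map-cong; map-upTo; map-applyUpTo; applyUpTo-∷ʳ; length-++; length-replicate)
open import Data.List.Relation.Unary.All using (All; []; _∷_)
import Data.List.Relation.Unary.All as All
import Data.List.Relation.Unary.All.Properties as All
open import Data.Product using (_×_; _,_; proj₁; proj₂)
open import Data.Sum using (_⊎_; inj₁; inj₂)
import Data.Sum as Sum
open import Data.Unit using (tt)
open import Function using (_∘_; id; const)
open import Function.Bundles using (module Equivalence)
open import Relation.Nullary using (¬_; Dec; yes; no; does; contradiction)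
open import Relation.Unary using (Decidable)
open import Relation.Binary.PropositionalEquality

-- No asymptotic formula for `P` enters. The term-by-term comparison closes because the recurrence
-- multiplies `P (y + e)` by `y + e` but `P y` only by `y`. The surplus `e * P y` must absorb the
-- boundary terms, whose number and coefficients are polynomial in `y + e`; the same recurrence
-- shows that `P` outgrows such polynomials. The price of passing from classes to `P` shapes the two
-- cases. For `c ≤ 5` every class is within distance two of a central one, so each passage shifts
-- the argument by 4; the three shifts add up to 12, and the target is
-- `6 * P (x + y + 12) ≤ P x * P y`, with 6 > c. It is established for `x, y ≥ 23`; for smaller `n`
-- the number `N d α n` is kept exactly and only the other factor is traded for `P`. For general `c`
-- the shift grows with `c`, and by `P (suc n) ≤ 2 * P n` it costs a factor exponential in `c`,
-- besides `c * c`. No fixed constant pays for that, hence the iteration that improves the constant.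

∑ : ℕ → (ℕ → ℕ) → ℕ
∑ zero    f = 0
∑ (suc n) f = f 0 + ∑ n (f ∘ suc)

∑-cong : ∀ n {f g : ℕ → ℕ} → (∀ i → i < n → f i ≡ g i) → ∑ n f ≡ ∑ n g
∑-cong zero    h = refl
∑-cong (suc n) h = cong₂ _+_ (h 0 z<s) (∑-cong n (λ i i<n → h (suc i) (s<s i<n)))

∑-mono-≤ : ∀ n {f g : ℕ → ℕ} → (∀ i → i < n → f i ≤ g i) → ∑ n f ≤ ∑ n g
∑-mono-≤ zero    h = z≤n
∑-mono-≤ (suc n) h = +-mono-≤ (h 0 z<s) (∑-mono-≤ n (λ i i<n → h (suc i) (s<s i<n)))

∑-const : ∀ n k → ∑ n (const k) ≡ n * k
∑-const zero    k = refl
∑-const (suc n) k = cong (k +_) (∑-const n k)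

∑-distrib-+ : ∀ n (f g : ℕ → ℕ) → ∑ n (λ i → f i + g i) ≡ ∑ n f + ∑ n g
∑-distrib-+ zero    f g = refl
∑-distrib-+ (suc n) f g rewrite ∑-distrib-+ n (f ∘ suc) (g ∘ suc) =
  interchange (f 0) (g 0) (∑ n (f ∘ suc)) (∑ n (g ∘ suc))
  where
  interchange : ∀ a b c d → a + b + (c + d) ≡ a + c + (b + d)
  interchange = solve-∀

*-distribˡ-∑ : ∀ n k (f : ℕ → ℕ) → ∑ n (λ i → k * f i) ≡ k * ∑ n f
*-distribˡ-∑ zero    k f = sym (*-zeroʳ k)
*-distribˡ-∑ (suc n) k f rewrite *-distribˡ-∑ n k (f ∘ suc) =
  sym (*-distribˡ-+ k (f 0) (∑ n (f ∘ suc)))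

∑-split : ∀ m n (f : ℕ → ℕ) → ∑ (m + n) f ≡ ∑ m f + ∑ n (λ i → f (m + i))
∑-split zero    n f = refl
∑-split (suc m) n f rewrite ∑-split m n (f ∘ suc) = sym (+-assoc (f 0) _ _)

∑-zero : ∀ n {f : ℕ → ℕ} → (∀ i → i < n → f i ≡ 0) → ∑ n f ≡ 0
∑-zero n h = trans (∑-cong n h) (trans (∑-const n 0) (*-zeroʳ n))

-- Weighted enumeration of overpartitions

total : (OverPartition → ℕ) → List OverPartition → ℕ
total W xs = sum (map W xs)

total-++ : ∀ W xs ys → total W (xs ++ ys) ≡ total W xs + total W ys
total-++ W xs ys = trans (cong sum (map-++ W xs ys)) (sum-++ (map W xs) (map W ys))

total-concatMap : ∀ {A : Set} W (g : A → List OverPartition) xs →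
  total W (concatMap g xs) ≡ sum (map (total W ∘ g) xs)
total-concatMap W g []       = refl
total-concatMap W g (x ∷ xs) =
  trans (total-++ W (g x) (concatMap g xs)) (cong (total W (g x) +_) (total-concatMap W g xs))

total-map : ∀ W (g : OverPartition → OverPartition) xs → total W (map g xs) ≡ total (W ∘ g) xs
total-map W g xs = sym (cong sum (map-∘ xs))

total-cong : ∀ {V W : OverPartition → ℕ} {xs} → All (λ x → V x ≡ W x) xs → total V xs ≡ total W xs
total-cong []       = refl
total-cong (p ∷ ps) = cong₂ _+_ p (total-cong ps)

sum-filter : ∀ {P : ℕ → Set} (P? : Decidable P) (g h : ℕ → ℕ) n →
  sum (map g (filter P? (applyUpTo h n))) ≡ ∑ n (λ i → if does (P? (h i)) then g (h i) else 0)
sum-filter P? g h zero    = refl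
sum-filter P? g h (suc n) with does (P? (h 0))
... | false = sum-filter P? g (h ∘ suc) n
... | true  = cong (g (h 0) +_) (sum-filter P? g (h ∘ suc) n)

withLargest : ℕ → ℕ → Bool → OverPartition → OverPartition
withLargest b j ov rest = ((suc b , ov) ∷ replicate j (suc b , false)) ++ rest

fits? : ∀ b n → Decidable (λ j → suc j * suc b ≤ n)
fits? b n j = suc j * suc b ≤? n

total-suc : ∀ W b n → total W (opsBounded (suc b) n) ≡
  total W (opsBounded b n) +
  ∑ (suc n) (λ j → if does (fits? b n j)
    then total (W ∘ withLargest b j true) (opsBounded b (n ∸ suc j * suc b)) +
         total (W ∘ withLargest b j false) (opsBounded b (n ∸ suc j * suc b))
    else 0)
total-suc W b n = trans (total-++ W (opsBounded b n) _) (cong (total W (opsBounded b n) +_)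
  (trans (total-concatMap W _ (filter (fits? b n) (upTo (suc n))))
  (trans (cong sum (map-cong both (filter (fits? b n) (upTo (suc n)))))
         (sum-filter (fits? b n) _ id (suc n)))))
  where
  both : ∀ j → total W (concatMap (λ ov → map (withLargest b j ov) (opsBounded b (n ∸ suc j * suc b)))
                                  (true ∷ false ∷ [])) ≡
    total (W ∘ withLargest b j true) (opsBounded b (n ∸ suc j * suc b)) +
    total (W ∘ withLargest b j false) (opsBounded b (n ∸ suc j * suc b))
  both j = trans
    (total-concatMap W (λ ov → map (withLargest b j ov) (opsBounded b (n ∸ suc j * suc b)))
                     (true ∷ false ∷ []))
    (cong₂ _+_ (total-map W (withLargest b j true) (opsBounded b (n ∸ suc j * suc b)))
      (trans (+-identityʳ _) (total-map W (withLargest b j false) (opsBounded b (n ∸ suc j * suc b)))))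

byParts : (ℕ → ℕ) → OverPartition → ℕ
byParts w p = w (numParts p)

byShape : (ℕ → ℕ → ℕ) → OverPartition → ℕ
byShape W p = W (largestPart p) (numParts p)

-- A weight is carried instead of a fixed count: removing a part turns `w` into `w ∘ suc`, so one
-- recurrence serves the plain count (`const 1`) and every residue condition on the number of parts.
E : ℕ → ℕ → (ℕ → ℕ) → ℕ
E b n w = total (byParts w) (opsBounded b n)

R : ℕ → ℕ → (ℕ → ℕ → ℕ) → ℕ
R b n W = total (byShape W) (opsBounded b n)

-- D b n w is the total weight of the overpartitions with largest part exactly suc b; the factor 2
-- is the choice of overlining it.
D-term : ℕ → ℕ → (ℕ → ℕ) → ℕ → ℕ
D-term b n w j = if does (fits? b n j) then 2 * E b (n ∸ suc j * suc b) (w ∘ (suc j +_)) else 0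

D : ℕ → ℕ → (ℕ → ℕ) → ℕ
D b n w = ∑ (suc n) (D-term b n w)

if-yes : ∀ {P : Set} (P? : Dec P) {k : ℕ} → P → (if does P? then k else 0) ≡ k
if-yes (yes _) p = refl
if-yes (no ¬p) p = contradiction p ¬p

if-no : ∀ {P : Set} (P? : Dec P) {k : ℕ} → ¬ P → (if does P? then k else 0) ≡ 0
if-no (yes p) ¬p = contradiction p ¬p
if-no (no _)  ¬p = refl

if-iff : ∀ {P Q : Set} (P? : Dec P) (Q? : Dec Q) → (P → Q) → (Q → P) →
  (if does P? then 1 else 0) ≡ (if does Q? then 1 else 0)
if-iff P? (yes q) f g = if-yes P? (g q)
if-iff P? (no ¬q) f g = if-no P? (¬q ∘ f)

D-term-big : ∀ b n w j → n < suc j * suc b → D-term b n w j ≡ 0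
D-term-big b n w j n< = if-no (fits? b n j) (<⇒≱ n<)

D-term-suc : ∀ b m w j → D-term b (m + suc b) w (suc j) ≡ D-term b m (w ∘ suc) j
D-term-suc b m w j with fits? b m j
... | yes p = trans
  (if-yes (fits? b (m + suc b) (suc j))
          (subst (_≤ m + suc b) (+-comm _ (suc b)) (+-monoˡ-≤ (suc b) p)))
  (trans
    (cong (λ k → 2 * E b k (w ∘ (suc (suc j) +_)))
      (trans (cong (_∸ suc (suc j) * suc b) (+-comm m (suc b)))
             ([m+n]∸[m+o]≡n∸o (suc b) m (suc j * suc b))))
    (sym (if-yes (fits? b m j) p)))
... | no ¬p = trans
  (D-term-big b (m + suc b) w (suc j)
    (≰⇒> (λ q → ¬p (+-cancelʳ-≤ (suc b) _ _ (subst (_≤ m + suc b) (+-comm (suc b) _) q)))))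
  (sym (if-no (fits? b m j) ¬p))

D-term-0 : ∀ b m w → D-term b (m + suc b) w 0 ≡ 2 * E b m (w ∘ suc)
D-term-0 b m w = trans
  (if-yes (fits? b (m + suc b) 0) (≤-trans (≤-reflexive (+-identityʳ (suc b))) (m≤n+m (suc b) m)))
  (cong (λ k → 2 * E b k (w ∘ suc))
        (trans (cong (m + suc b ∸_) (+-identityʳ (suc b))) (m+n∸n≡m m (suc b))))

D-small : ∀ b n w → n < suc b → D b n w ≡ 0
D-small b n w n<b = ∑-zero (suc n) (λ j _ → D-term-big b n w j (<-≤-trans n<b (m≤m+n (suc b) _)))

-- One copy of the largest part `suc b` is removed: either it was the only one, which leaves parts
-- at most `b` and two choices of the overline, or `suc b` is still the largest part.
D-rec : ∀ b m w → D b (m + suc b) w ≡ 2 * E b m (w ∘ suc) + D b m (w ∘ suc)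
D-rec b m w = cong₂ _+_ (D-term-0 b m w) (begin
  ∑ (m + suc b) (D-term b (m + suc b) w ∘ suc)
    ≡⟨ ∑-cong (m + suc b) (λ j _ → D-term-suc b m w j) ⟩
  ∑ (m + suc b) (D-term b m (w ∘ suc))
    ≡⟨ cong (λ k → ∑ k (D-term b m (w ∘ suc))) (+-suc m b) ⟩
  ∑ (suc m + b) (D-term b m (w ∘ suc))
    ≡⟨ ∑-split (suc m) b (D-term b m (w ∘ suc)) ⟩
  D b m (w ∘ suc) + ∑ b (λ i → D-term b m (w ∘ suc) (suc m + i))
    -- The sum for `m + suc b` runs over more multiplicities than the one for `m`; the `b` surplus
    -- ones ask for more than `m` copies of a positive part.
    ≡⟨ cong (D b m (w ∘ suc) +_) (∑-zero b (λ i _ → D-term-big b m (w ∘ suc) (suc m + i)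
         (<-≤-trans (s≤s (≤-trans (m≤m+n m i) (n≤1+n _))) (m≤m*n (suc (suc m + i)) (suc b))))) ⟩
  D b m (w ∘ suc) + 0
    ≡⟨ +-identityʳ _ ⟩
  D b m (w ∘ suc) ∎)
  where open ≡-Reasoning

total-D : ∀ W w b n →
  (∀ j ov {m} → All (λ p → W (withLargest b j ov p) ≡ w (suc j + numParts p)) (opsBounded b m)) →
  total W (opsBounded (suc b) n) ≡ total W (opsBounded b n) + D b n w
total-D W w b n h = trans (total-suc W b n) (cong (total W (opsBounded b n) +_)
  (∑-cong (suc n) (λ j _ → cong (if does (fits? b n j) then_else 0) (choices j))))
  where
  double : ∀ k → k + k ≡ 2 * k
  double = solve-∀
  choices : ∀ j →
    total (W ∘ withLargest b j true) (opsBounded b (n ∸ suc j * suc b)) +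
    total (W ∘ withLargest b j false) (opsBounded b (n ∸ suc j * suc b)) ≡
    2 * E b (n ∸ suc j * suc b) (w ∘ (suc j +_))
  choices j = trans
    (cong₂ _+_ (total-cong (h j true {n ∸ suc j * suc b})) (total-cong (h j false {n ∸ suc j * suc b})))
    (double (E b (n ∸ suc j * suc b) (w ∘ (suc j +_))))

numParts-withLargest : ∀ b j ov p → numParts (withLargest b j ov p) ≡ suc j + numParts p
numParts-withLargest b j ov p = cong suc
  (trans (length-++ (replicate j (suc b , false))) (cong (_+ numParts p) (length-replicate j)))

largestPart-replicate : ∀ b j p → largestPart p ≤ b → largestPart (replicate j (b , false) ++ p) ≤ b
largestPart-replicate b zero    p h = h
largestPart-replicate b (suc j) p h = ⊔-lub ≤-refl (largestPart-replicate b j p h)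

largestPart-withLargest : ∀ b j ov p → largestPart p ≤ b → largestPart (withLargest b j ov p) ≡ suc b
largestPart-withLargest b j ov p h =
  m≥n⇒m⊔n≡m (largestPart-replicate (suc b) j p (m≤n⇒m≤1+n h))

largestPart≤ : ∀ b n → All (λ p → largestPart p ≤ b) (opsBounded b n)
largestPart≤ zero    zero    = z≤n ∷ []
largestPart≤ zero    (suc n) = []
largestPart≤ (suc b) n = All.++⁺ (All.map m≤n⇒m≤1+n (largestPart≤ b n))
  (All.concat⁺ (All.map⁺ (All.universal copies (filter (fits? b n) (upTo (suc n))))))
  where
  overlined : ∀ j ov → All (λ p → largestPart p ≤ suc b)
                           (map (withLargest b j ov) (opsBounded b (n ∸ suc j * suc b)))
  overlined j ov = All.map⁺ (All.map (λ {p} h → ≤-reflexive (largestPart-withLargest b j ov p h))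
                                     (largestPart≤ b (n ∸ suc j * suc b)))
  copies : ∀ j → All (λ p → largestPart p ≤ suc b) (concatMap
    (λ ov → map (withLargest b j ov) (opsBounded b (n ∸ suc j * suc b))) (true ∷ false ∷ []))
  copies j = All.concat⁺ (All.map⁺ (All.universal (overlined j) (true ∷ false ∷ [])))

E-D : ∀ b n w → E (suc b) n w ≡ E b n w + D b n w
E-D b n w = total-D (byParts w) w b n
  (λ j ov → All.universal (λ p → cong w (numParts-withLargest b j ov p)) _)

R-D : ∀ b n W → R (suc b) n W ≡ R b n W + D b n (W (suc b))
R-D b n W = total-D (byShape W) (W (suc b)) b n (λ j ov {m} →
  All.map (λ {p} h → cong₂ W (largestPart-withLargest b j ov p h) (numParts-withLargest b j ov p))
          (largestPart≤ b m))

E-small : ∀ b n w → n < suc b → E (suc b) n w ≡ E b n w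
E-small b n w n<b = trans (E-D b n w) (trans (cong (E b n w +_) (D-small b n w n<b)) (+-identityʳ _))

R-small : ∀ b n W → n < suc b → R (suc b) n W ≡ R b n W
R-small b n W n<b =
  trans (R-D b n W) (trans (cong (R b n W +_) (D-small b n (W (suc b)) n<b)) (+-identityʳ _))

D-+ : ∀ b m w → D b (m + suc b) w ≡ E b m (w ∘ suc) + E (suc b) m (w ∘ suc)
D-+ b m w rewrite D-rec b m w | E-D b m (w ∘ suc) = reassoc (E b m (w ∘ suc)) (D b m (w ∘ suc))
  where
  reassoc : ∀ x y → 2 * x + y ≡ x + (x + y)
  reassoc = solve-∀

-- Coefficient form of (1 - z q^β) G_β = (1 + z q^β) G_(β-1) with β = `suc b`, where z marks the
-- parts and G_β is the generating function of overpartitions with parts at most β.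
E-rec : ∀ b m w →
  E (suc b) (m + suc b) w ≡ E b (m + suc b) w + (E b m (w ∘ suc) + E (suc b) m (w ∘ suc))
E-rec b m w = trans (E-D b (m + suc b) w) (cong (E b (m + suc b) w +_) (D-+ b m w))

R-rec : ∀ b m W → R (suc b) (m + suc b) W ≡
  R b (m + suc b) W + (E b m (W (suc b) ∘ suc) + E (suc b) m (W (suc b) ∘ suc))
R-rec b m W = trans (R-D b (m + suc b) W) (cong (R b (m + suc b) W +_) (D-+ b m (W (suc b))))

E-cong : ∀ b n {v w : ℕ → ℕ} → (∀ t → v t ≡ w t) → E b n v ≡ E b n w
E-cong b n h = total-cong (All.universal (λ p → h (numParts p)) (opsBounded b n))

R-cong : ∀ b n {V W : ℕ → ℕ → ℕ} → (∀ l t → V l t ≡ W l t) → R b n V ≡ R b n W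
R-cong b n h = total-cong (All.universal (λ p → h (largestPart p) (numParts p)) (opsBounded b n))

total-zero : ∀ xs → total (const 0) xs ≡ 0
total-zero []       = refl
total-zero (_ ∷ xs) = total-zero xs

total-+ : ∀ (V W : OverPartition → ℕ) xs → total (λ p → V p + W p) xs ≡ total V xs + total W xs
total-+ V W []       = refl
total-+ V W (x ∷ xs) rewrite total-+ V W xs = interchange (V x) (W x) (total V xs) (total W xs)
  where
  interchange : ∀ a b c d → a + b + (c + d) ≡ a + c + (b + d)
  interchange = solve-∀

∑-total : ∀ m (W : ℕ → OverPartition → ℕ) xs →
  ∑ m (λ i → total (W i) xs) ≡ total (λ p → ∑ m (λ i → W i p)) xs
∑-total zero    W xs = sym (total-zero xs)
∑-total (suc m) W xs = trans (cong (total (W 0) xs +_) (∑-total m (W ∘ suc) xs))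
  (sym (total-+ (W 0) (λ p → ∑ m (λ i → W (suc i) p)) xs))

E≤E-suc : ∀ b n w → E b n w ≤ E (suc b) n w
E≤E-suc b n w = subst (E b n w ≤_) (sym (E-D b n w)) (m≤m+n _ _)

R≤R-suc : ∀ b n W → R b n W ≤ R (suc b) n W
R≤R-suc b n W = subst (R b n W ≤_) (sym (R-D b n W)) (m≤m+n _ _)

E-stable : ∀ k n w → E (k + n) n w ≡ E n n w
E-stable zero    n w = refl
E-stable (suc k) n w = trans (E-small (k + n) n w (s≤s (m≤n+m n k))) (E-stable k n w)

R-stable : ∀ k n W → R (k + n) n W ≡ R n n W
R-stable zero    n W = refl
R-stable (suc k) n W = trans (R-small (k + n) n W (s≤s (m≤n+m n k))) (R-stable k n W)

-- Induction by steps of one part size; inserting a part and raising the largest part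

data Below-or-Above (b : ℕ) : ℕ → Set where
  below : ∀ {n} → n < b → Below-or-Above b n
  above : ∀ m → Below-or-Above b (m + b)

below-or-above : ∀ b n → Below-or-Above b n
below-or-above b n with n <? b
... | yes n<b = below n<b
... | no  n≮b = subst (Below-or-Above b) (m∸n+n≡m (≮⇒≥ n≮b)) (above (n ∸ b))

step-rec : ∀ b (Q : ℕ → Set) → (∀ n → n < suc b → Q n) → (∀ m → Q m → Q (m + suc b)) → ∀ n → Q n
step-rec b Q base step = <-rec Q go
  where
  go : ∀ n → (∀ {m} → m < n → Q m) → Q n
  go n ih with below-or-above (suc b) n
  ... | below n<b = base n n<b
  ... | above m   = step m (ih (m<m+n m z<s))

-- This is the injection that inserts a plain part `suc k`, but no map is built. At bound `suc k`
-- the left side is a summand of `E-rec`; for larger bounds the recurrence at the top part commutes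
-- with the shift by `suc k`.
E-addPart : ∀ j k m w → E (j + suc k) m (w ∘ suc) ≤ E (j + suc k) (m + suc k) w
E-addPart zero    k m w = subst (E (suc k) m (w ∘ suc) ≤_) (sym (E-rec k m w))
  (≤-trans (m≤n+m _ (E k m (w ∘ suc))) (m≤n+m _ (E k (m + suc k) w)))
E-addPart (suc j) k n w = step-rec (j + suc k)
  (λ n → ∀ w → E (suc (j + suc k)) n (w ∘ suc) ≤ E (suc (j + suc k)) (n + suc k) w) base step n w
  where
  b = j + suc k
  base : ∀ n → n < suc b → ∀ w → E (suc b) n (w ∘ suc) ≤ E (suc b) (n + suc k) w
  base n n<b w = begin
    E (suc b) n (w ∘ suc)    ≡⟨ E-small b n (w ∘ suc) n<b ⟩
    E b n (w ∘ suc)          ≤⟨ E-addPart j k n w ⟩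
    E b (n + suc k) w        ≤⟨ E≤E-suc b (n + suc k) w ⟩
    E (suc b) (n + suc k) w  ∎
    where open ≤-Reasoning
  swap : ∀ m b k → m + b + k ≡ m + k + b
  swap = solve-∀
  step : ∀ m → (∀ w → E (suc b) m (w ∘ suc) ≤ E (suc b) (m + suc k) w) →
    ∀ w → E (suc b) (m + suc b) (w ∘ suc) ≤ E (suc b) (m + suc b + suc k) w
  step m ih w = begin
    E (suc b) (m + suc b) (w ∘ suc)
      ≡⟨ E-rec b m (w ∘ suc) ⟩
    E b (m + suc b) (w ∘ suc) + (E b m (w ∘ suc ∘ suc) + E (suc b) m (w ∘ suc ∘ suc))
      ≤⟨ +-mono-≤ (E-addPart j k (m + suc b) w) (+-mono-≤ (E-addPart j k m (w ∘ suc)) (ih (w ∘ suc))) ⟩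
    E b (m + suc b + suc k) w + (E b (m + suc k) (w ∘ suc) + E (suc b) (m + suc k) (w ∘ suc))
      ≡⟨ cong (λ i → E b i w + (E b (m + suc k) (w ∘ suc) + E (suc b) (m + suc k) (w ∘ suc)))
              (swap m (suc b) (suc k)) ⟩
    E b (m + suc k + suc b) w + (E b (m + suc k) (w ∘ suc) + E (suc b) (m + suc k) (w ∘ suc))
      ≡⟨ E-rec b (m + suc k) w ⟨
    E (suc b) (m + suc k + suc b) w
      ≡⟨ cong (λ i → E (suc b) i w) (swap m (suc b) (suc k)) ⟨
    E (suc b) (m + suc b + suc k) w ∎
    where open ≤-Reasoning

E-addOne : ∀ b m w → E (suc b) m (w ∘ suc) ≤ E (suc b) (suc m) w
E-addOne b m w = subst₂ (λ i k → E i m (w ∘ suc) ≤ E i k w) (+-comm b 1) (+-comm m 1)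
  (E-addPart b 0 m w)

E-addTwo : ∀ b m w → E (2 + b) m (w ∘ suc) ≤ E (2 + b) (2 + m) w
E-addTwo b m w = subst₂ (λ i k → E i m (w ∘ suc) ≤ E i k w) (+-comm b 2) (+-comm m 2)
  (E-addPart b 1 m w)

-- Replacing one largest part `suc b` by `2 + b` keeps the remainder `m` and only relaxes the bound
-- on its parts. The empty overpartition has no part to raise, hence `0 < n`.
R-raiseLargest : ∀ b n W → 0 < n → R b n (W ∘ suc) ≤ R (suc b) (suc n) W
R-raiseLargest zero    (suc n) W _ = z≤n
R-raiseLargest (suc b) n W 0<n with below-or-above (suc b) n
... | below n<b = begin
  R (suc b) n (W ∘ suc)    ≡⟨ R-small b n (W ∘ suc) n<b ⟩
  R b n (W ∘ suc)          ≤⟨ R-raiseLargest b n W 0<n ⟩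
  R (suc b) (suc n) W      ≤⟨ R≤R-suc (suc b) (suc n) W ⟩
  R (2 + b) (suc n) W      ∎
  where open ≤-Reasoning
... | above m = begin
  R (suc b) (m + suc b) (W ∘ suc)
    ≡⟨ R-rec b m (W ∘ suc) ⟩
  R b (m + suc b) (W ∘ suc) + (E b m (W (2 + b) ∘ suc) + E (suc b) m (W (2 + b) ∘ suc))
    ≤⟨ +-mono-≤ (R-raiseLargest b (m + suc b) W 0<n)
         (+-mono-≤ (E≤E-suc b m (W (2 + b) ∘ suc)) (E≤E-suc (suc b) m (W (2 + b) ∘ suc))) ⟩
  R (suc b) (suc (m + suc b)) W + (E (suc b) m (W (2 + b) ∘ suc) + E (2 + b) m (W (2 + b) ∘ suc))
    ≡⟨ cong (λ i → R (suc b) i W + (E (suc b) m (W (2 + b) ∘ suc) + E (2 + b) m (W (2 + b) ∘ suc)))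
            (sym (+-suc m (suc b))) ⟩
  R (suc b) (m + (2 + b)) W + (E (suc b) m (W (2 + b) ∘ suc) + E (2 + b) m (W (2 + b) ∘ suc))
    ≡⟨ R-rec (suc b) m W ⟨
  R (2 + b) (m + (2 + b)) W
    ≡⟨ cong (λ i → R (2 + b) i W) (+-suc m (suc b)) ⟩
  R (2 + b) (suc (m + suc b)) W ∎
  where open ≤-Reasoning

-- At `b = 0` the first term has no room for a part 1, but there the pair as a whole is a summand of
-- `E 1 (suc m) w`.
E-pair-addOne : ∀ b m w →
  E b m (w ∘ suc) + E (suc b) m (w ∘ suc) ≤ E b (suc m) w + E (suc b) (suc m) w
E-pair-addOne zero m w = ≤-trans
  (≤-trans (m≤n+m _ (E 0 (m + 1) w)) (≤-reflexive (trans (sym (E-rec 0 m w)) (cong (λ i → E 1 i w) (+-comm m 1)))))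
  (m≤n+m _ (E 0 (suc m) w))
E-pair-addOne (suc b) m w = +-mono-≤ (E-addOne b m w) (E-addOne (suc b) m w)

-- The bounds rise by one as well, since this is applied while the largest part is being raised; 2
-- is the least bound that admits a part 2.
E-pair-addTwo : ∀ b m w →
  E b m (w ∘ suc) + E (suc b) m (w ∘ suc) ≤ E (suc b) (2 + m) w + E (2 + b) (2 + m) w
E-pair-addTwo zero m w = begin
  E 0 m (w ∘ suc) + E 1 m (w ∘ suc)
    ≤⟨ +-mono-≤ (E≤E-suc 0 m (w ∘ suc)) (E≤E-suc 1 m (w ∘ suc)) ⟩
  E 1 m (w ∘ suc) + E 2 m (w ∘ suc)
    ≤⟨ m≤n+m _ (E 1 (m + 2) w) ⟩
  E 1 (m + 2) w + (E 1 m (w ∘ suc) + E 2 m (w ∘ suc))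
    ≡⟨ E-rec 1 m w ⟨
  E 2 (m + 2) w
    ≡⟨ cong (λ i → E 2 i w) (+-comm m 2) ⟩
  E 2 (2 + m) w
    ≤⟨ m≤n+m _ (E 1 (2 + m) w) ⟩
  E 1 (2 + m) w + E 2 (2 + m) w ∎
  where open ≤-Reasoning
E-pair-addTwo (suc b) m w = +-mono-≤
  (≤-trans (E≤E-suc (suc b) m (w ∘ suc)) (E-addTwo b m w))
  (≤-trans (E≤E-suc (2 + b) m (w ∘ suc)) (E-addTwo (suc b) m w))

R-addOne : ∀ b n W → 0 < n → R b n (λ l t → W l (suc t)) ≤ R b (suc n) W
R-addOne zero    (suc n) W _ = z≤n
R-addOne (suc b) n W 0<n with below-or-above (suc b) n
... | below n<b = begin
  R (suc b) n (λ l t → W l (suc t))  ≡⟨ R-small b n (λ l t → W l (suc t)) n<b ⟩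
  R b n (λ l t → W l (suc t))        ≤⟨ R-addOne b n W 0<n ⟩
  R b (suc n) W                      ≤⟨ R≤R-suc b (suc n) W ⟩
  R (suc b) (suc n) W                ∎
  where open ≤-Reasoning
... | above m = begin
  R (suc b) (m + suc b) V
    ≡⟨ R-rec b m V ⟩
  R b (m + suc b) V + (E b m (V (suc b) ∘ suc) + E (suc b) m (V (suc b) ∘ suc))
    ≤⟨ +-mono-≤ (R-addOne b (m + suc b) W 0<n) (E-pair-addOne b m (W (suc b) ∘ suc)) ⟩
  R b (suc m + suc b) W + (E b (suc m) (W (suc b) ∘ suc) + E (suc b) (suc m) (W (suc b) ∘ suc))
    ≡⟨ R-rec b (suc m) W ⟨
  R (suc b) (suc m + suc b) W ∎
  where
  open ≤-Reasoning
  V : ℕ → ℕ → ℕ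
  V l t = W l (suc t)

-- The two moves together keep the rank and add 3, an odd amount. They are combined because a part 2
-- added to an overpartition into ones would change the largest part; once that part has been
-- raised, it is at least 2.
R-raiseLargest-addTwo : ∀ b n W → 0 < n → R b n (λ l t → W (suc l) (suc t)) ≤ R (suc b) (3 + n) W
R-raiseLargest-addTwo zero    (suc n) W _ = z≤n
R-raiseLargest-addTwo (suc b) n W 0<n with below-or-above (suc b) n
... | below n<b = begin
  R (suc b) n (λ l t → W (suc l) (suc t))  ≡⟨ R-small b n (λ l t → W (suc l) (suc t)) n<b ⟩
  R b n (λ l t → W (suc l) (suc t))        ≤⟨ R-raiseLargest-addTwo b n W 0<n ⟩
  R (suc b) (3 + n) W                      ≤⟨ R≤R-suc (suc b) (3 + n) W ⟩
  R (2 + b) (3 + n) W                      ∎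
  where open ≤-Reasoning
... | above m = begin
  R (suc b) (m + suc b) V
    ≡⟨ R-rec b m V ⟩
  R b (m + suc b) V + (E b m (V (suc b) ∘ suc) + E (suc b) m (V (suc b) ∘ suc))
    ≤⟨ +-mono-≤ (R-raiseLargest-addTwo b (m + suc b) W 0<n) (E-pair-addTwo b m w) ⟩
  R (suc b) (3 + (m + suc b)) W + (E (suc b) (2 + m) w + E (2 + b) (2 + m) w)
    ≡⟨ cong (λ i → R (suc b) i W + (E (suc b) (2 + m) w + E (2 + b) (2 + m) w)) (shift m b) ⟩
  R (suc b) (2 + m + (2 + b)) W + (E (suc b) (2 + m) w + E (2 + b) (2 + m) w)
    ≡⟨ R-rec (suc b) (2 + m) W ⟨
  R (2 + b) (2 + m + (2 + b)) W
    ≡⟨ cong (λ i → R (2 + b) i W) (shift m b) ⟨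
  R (2 + b) (3 + (m + suc b)) W ∎
  where
  open ≤-Reasoning
  V : ℕ → ℕ → ℕ
  V l t = W (suc l) (suc t)
  w : ℕ → ℕ
  w = W (2 + b) ∘ suc
  shift : ∀ m b → 3 + (m + suc b) ≡ 2 + m + (2 + b)
  shift = solve-∀

-- Rank residue classes.  The modulus is c = suc d, and α + d·l + t ≡ α − (l − t) (mod c), so that
-- N d α n counts the overpartitions of n whose rank is congruent to α.

χ : ℕ → ℕ → ℕ
χ d k = if does (suc d ℕD.∣? k) then 1 else 0

χ-periodic : ∀ d k → χ d (k + suc d) ≡ χ d k
χ-periodic d k = if-iff (suc d ℕD.∣? (k + suc d)) (suc d ℕD.∣? k)
  (λ h → ℕD.∣m+n∣m⇒∣n (subst (suc d ℕD.∣_) (+-comm k (suc d)) h) ℕD.∣-refl)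
  (λ h → ℕD.∣m∣n⇒∣m+n h ℕD.∣-refl)

∑-snoc : ∀ n (f : ℕ → ℕ) → ∑ (suc n) f ≡ ∑ n f + f n
∑-snoc zero    f = +-comm (f 0) 0
∑-snoc (suc n) f rewrite ∑-snoc n (f ∘ suc) = sym (+-assoc (f 0) _ _)

∑-χ : ∀ d k → ∑ (suc d) (λ i → χ d (k + i)) ≡ 1
∑-χ d zero = cong₂ _+_ (if-yes (suc d ℕD.∣? 0) (ℕD.divides 0 refl))
  (∑-zero d (λ i i<d → if-no (suc d ℕD.∣? suc i) (λ h → <⇒≱ (s<s i<d) (ℕD.∣⇒≤ h))))
∑-χ d (suc k) = begin
  ∑ (suc d) (λ i → χ d (suc k + i))
    ≡⟨ ∑-snoc d (λ i → χ d (suc k + i)) ⟩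
  ∑ d (λ i → χ d (suc k + i)) + χ d (suc k + d)
    ≡⟨ cong₂ _+_ (∑-cong d (λ i _ → cong (χ d) (sym (+-suc k i))))
                 (trans (cong (χ d) (sym (+-suc k d))) (χ-periodic d k)) ⟩
  ∑ d (λ i → χ d (k + suc i)) + χ d k
    ≡⟨ +-comm _ (χ d k) ⟩
  χ d k + ∑ d (λ i → χ d (k + suc i))
    ≡⟨ cong (λ j → χ d j + ∑ d (λ i → χ d (k + suc i))) (+-identityʳ k) ⟨
  ∑ (suc d) (λ i → χ d (k + i))
    ≡⟨ ∑-χ d k ⟩
  1 ∎
  where open ≡-Reasoning

rankClass : ℕ → ℕ → ℕ → ℕ → ℕ
rankClass d α l t = χ d (α + d * l + t)

N : ℕ → ℕ → ℕ → ℕ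
N d α n = R n n (rankClass d α)

P : ℕ → ℕ
P n = E n n (const 1)

∑-N : ∀ d α n → ∑ (suc d) (λ i → N d (α + i) n) ≡ P n
∑-N d α n = trans (∑-total (suc d) (λ i → byShape (rankClass d (α + i))) (opsBounded n n))
  (R-cong n n (λ l t → trans (∑-cong (suc d) (λ i _ → cong (χ d) (swap α i (d * l) t)))
                             (∑-χ d (α + d * l + t))))
  where
  swap : ∀ α i x t → α + i + x + t ≡ α + x + t + i
  swap = solve-∀

N-periodic : ∀ d α n → N d (α + suc d) n ≡ N d α n
N-periodic d α n = R-cong n n (λ l t → trans (cong (χ d) (swap α d (d * l) t)) (χ-periodic d (α + d * l + t)))
  where
  swap : ∀ α d x t → α + suc d + x + t ≡ α + x + t + suc d
  swap = solve-∀

N-up : ∀ d α n → 0 < n → N d α n ≤ N d (suc α) (suc n)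
N-up d α n 0<n = subst (_≤ N d (suc α) (suc n))
  (R-cong n n (λ l t → trans (cong (χ d) (shift α d l t)) (χ-periodic d (α + d * l + t))))
  (R-raiseLargest n n (rankClass d (suc α)) 0<n)
  where
  shift : ∀ α d l t → suc α + d * suc l + t ≡ α + d * l + t + suc d
  shift = solve-∀

N-down : ∀ d α n → 0 < n → N d (suc α) n ≤ N d α (suc n)
N-down d α n 0<n = begin
  N d (suc α) n                              ≡⟨ R-cong n n (λ l t → cong (χ d) (sym (+-suc (α + d * l) t))) ⟩
  R n n (λ l t → rankClass d α l (suc t))    ≤⟨ R-addOne n n (rankClass d α) 0<n ⟩
  R n (suc n) (rankClass d α)                ≤⟨ R≤R-suc n (suc n) (rankClass d α) ⟩
  N d α (suc n)                              ∎
  where open ≤-Reasoning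

N-stay₃ : ∀ d α n → 0 < n → N d α n ≤ N d α (3 + n)
N-stay₃ d α n 0<n = begin
  N d α n
    ≡⟨ R-cong n n (λ l t → trans (cong (χ d) (shift α d l t)) (χ-periodic d (α + d * l + t))) ⟨
  R n n (λ l t → rankClass d α (suc l) (suc t))
    ≤⟨ R-raiseLargest-addTwo n n (rankClass d α) 0<n ⟩
  R (suc n) (3 + n) (rankClass d α)
    ≤⟨ R≤R-suc (suc n) (3 + n) (rankClass d α) ⟩
  R (2 + n) (3 + n) (rankClass d α)
    ≤⟨ R≤R-suc (2 + n) (3 + n) (rankClass d α) ⟩
  N d α (3 + n) ∎
  where
  open ≤-Reasoning
  shift : ∀ α d l t → α + d * suc l + suc t ≡ α + d * l + t + suc d
  shift = solve-∀

-- One step up and one step down add 2, `N-stay₃` adds 3, and every number from 2 on is a sum of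
-- twos and at most one 3.
N-stay : ∀ k d α n → 0 < n → N d α n ≤ N d α (2 + k + n)
N-stay zero          d α n 0<n = ≤-trans (N-up d α n 0<n) (N-down d α (suc n) z<s)
N-stay (suc zero)    d α n 0<n = N-stay₃ d α n 0<n
N-stay (suc (suc k)) d α n 0<n = ≤-trans (N-stay k d α n 0<n) (N-stay zero d α (2 + k + n) z<s)

N-downs : ∀ j d α n → 0 < n → N d (j + α) n ≤ N d α (j + n)
N-downs zero    d α n 0<n = ≤-refl
N-downs (suc j) d α n 0<n = ≤-trans (N-down d (j + α) n 0<n)
  (subst (λ i → N d (j + α) (suc n) ≤ N d α i) (+-suc j n) (N-downs j d α (suc n) z<s))

-- With at most five classes, each is within distance two of the central class `2 + α`. The four
-- units split as 2 + 1 + 1, 3 + 1 or 2 + 2 for distance two, one or zero: a stay, completed by unit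
-- steps up or down.
N-four : ∀ i d α n → i ≤ 4 → 0 < n → N d (i + α) n ≤ N d (2 + α) (4 + n)
N-four 0 d α n _ 0<n = ≤-trans (N-stay 0 d α n 0<n)
  (≤-trans (N-up d α (2 + n) z<s) (N-up d (1 + α) (3 + n) z<s))
N-four 1 d α n _ 0<n = ≤-trans (N-stay 1 d (1 + α) n 0<n) (N-up d (1 + α) (3 + n) z<s)
N-four 2 d α n _ 0<n = N-stay 2 d (2 + α) n 0<n
N-four 3 d α n _ 0<n = ≤-trans (N-stay 1 d (3 + α) n 0<n) (N-down d (2 + α) (3 + n) z<s)
N-four 4 d α n _ 0<n = ≤-trans (N-stay 0 d (4 + α) n 0<n)
  (≤-trans (N-down d (3 + α) (2 + n) z<s) (N-down d (2 + α) (3 + n) z<s))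
N-four (suc (suc (suc (suc (suc _))))) d α n (s≤s (s≤s (s≤s (s≤s ())))) 0<n

N-four′ : ∀ i d α n → i ≤ 4 → 0 < n → N d (2 + α) n ≤ N d (i + α) (4 + n)
N-four′ 0 d α n _ 0<n = ≤-trans (N-stay 0 d (2 + α) n 0<n)
  (≤-trans (N-down d (1 + α) (2 + n) z<s) (N-down d α (3 + n) z<s))
N-four′ 1 d α n _ 0<n = ≤-trans (N-stay 1 d (2 + α) n 0<n) (N-down d (1 + α) (3 + n) z<s)
N-four′ 2 d α n _ 0<n = N-stay 2 d (2 + α) n 0<n
N-four′ 3 d α n _ 0<n = ≤-trans (N-stay 1 d (2 + α) n 0<n) (N-up d (2 + α) (3 + n) z<s)
N-four′ 4 d α n _ 0<n = ≤-trans (N-stay 0 d (2 + α) n 0<n)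
  (≤-trans (N-up d (2 + α) (2 + n) z<s) (N-up d (3 + α) (3 + n) z<s))
N-four′ (suc (suc (suc (suc (suc _))))) d α n (s≤s (s≤s (s≤s (s≤s ())))) 0<n

P≤c*N : ∀ d α n → d ≤ 4 → 0 < n → P n ≤ suc d * N d (2 + α) (4 + n)
P≤c*N d α n d≤4 0<n = begin
  P n                                  ≡⟨ ∑-N d α n ⟨
  ∑ (suc d) (λ i → N d (α + i) n)      ≤⟨ ∑-mono-≤ (suc d) (λ i i≤d →
    subst (λ j → N d j n ≤ N d (2 + α) (4 + n)) (+-comm i α)
          (N-four i d α n (≤-trans (s≤s⁻¹ i≤d) d≤4) 0<n)) ⟩
  ∑ (suc d) (const (N d (2 + α) (4 + n))) ≡⟨ ∑-const (suc d) _ ⟩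
  suc d * N d (2 + α) (4 + n)          ∎
  where open ≤-Reasoning

c*N≤P : ∀ d α n → d ≤ 4 → 0 < n → suc d * N d (2 + α) n ≤ P (4 + n)
c*N≤P d α n d≤4 0<n = begin
  suc d * N d (2 + α) n                ≡⟨ ∑-const (suc d) _ ⟨
  ∑ (suc d) (const (N d (2 + α) n))    ≤⟨ ∑-mono-≤ (suc d) (λ i i≤d →
    subst (λ j → N d (2 + α) n ≤ N d j (4 + n)) (+-comm i α)
          (N-four′ i d α n (≤-trans (s≤s⁻¹ i≤d) d≤4) 0<n)) ⟩
  ∑ (suc d) (λ i → N d (α + i) (4 + n)) ≡⟨ ∑-N d α (4 + n) ⟩
  P (4 + n)                            ∎
  where open ≤-Reasoning

-- Class `α + i` reaches `α` by `i` steps down; the remaining `2 + (d ∸ i)` units are spent inside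
-- the class. The extra 2 is the least amount for which `N-stay` applies.
P≤c*N-wide : ∀ d α n → 0 < n → P n ≤ suc d * N d α (2 + d + n)
P≤c*N-wide d α n 0<n = begin
  P n                                  ≡⟨ ∑-N d α n ⟨
  ∑ (suc d) (λ i → N d (α + i) n)      ≤⟨ ∑-mono-≤ (suc d) (λ i i≤d → oneClass i (s≤s⁻¹ i≤d)) ⟩
  ∑ (suc d) (const (N d α (2 + d + n))) ≡⟨ ∑-const (suc d) _ ⟩
  suc d * N d α (2 + d + n)            ∎
  where
  open ≤-Reasoning
  oneClass : ∀ i → i ≤ d → N d (α + i) n ≤ N d α (2 + d + n)
  oneClass i i≤d = begin
    N d (α + i) n                   ≡⟨ cong (λ j → N d j n) (+-comm α i) ⟩
    N d (i + α) n                   ≤⟨ N-downs i d α n 0<n ⟩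
    N d α (i + n)                   ≤⟨ N-stay (d ∸ i) d α (i + n) (≤-trans 0<n (m≤n+m n i)) ⟩
    N d α (2 + (d ∸ i) + (i + n))   ≡⟨ cong (λ j → N d α (2 + j)) (+-assoc (d ∸ i) i n) ⟨
    N d α (2 + ((d ∸ i) + i + n))   ≡⟨ cong (λ j → N d α (2 + (j + n))) (m∸n+n≡m i≤d) ⟩
    N d α (2 + d + n)               ∎

N≤P : ∀ d α n → N d α n ≤ P n
N≤P d α n = begin
  N d α n                              ≡⟨ cong (λ j → N d j n) (+-identityʳ α) ⟨
  N d (α + 0) n                        ≤⟨ m≤m+n _ _ ⟩
  ∑ (suc d) (λ i → N d (α + i) n)      ≡⟨ ∑-N d α n ⟩
  P n                                  ∎
  where open ≤-Reasoning

-- The logarithmic derivative of ∏ (1 + qᵇ)/(1 − qᵇ)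

F : ℕ → ℕ → ℕ
F b n = E b n (const 1)

F-rec : ∀ b m → F (suc b) (m + suc b) ≡ F b (m + suc b) + (F b m + F (suc b) m)
F-rec b m = E-rec b m (const 1)

F-small : ∀ b n → n < suc b → F (suc b) n ≡ F b n
F-small b n = E-small b n (const 1)

conv : (ℕ → ℕ) → (ℕ → ℕ) → ℕ → ℕ
conv f g n = ∑ (suc n) (λ k → f k * g (n ∸ k))

conv-congʳ : ∀ f {g h : ℕ → ℕ} n → (∀ k → k ≤ n → g k ≡ h k) → conv f g n ≡ conv f h n
conv-congʳ f n e = ∑-cong (suc n) (λ k _ → cong (f k *_) (e (n ∸ k) (m∸n≤m n k)))

conv-distribʳ-+ : ∀ f g h n → conv (λ k → f k + g k) h n ≡ conv f h n + conv g h n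
conv-distribʳ-+ f g h n = trans
  (∑-cong (suc n) (λ k _ → *-distribʳ-+ (h (n ∸ k)) (f k) (g k)))
  (∑-distrib-+ (suc n) (λ k → f k * h (n ∸ k)) (λ k → g k * h (n ∸ k)))

conv-vanish : ∀ f g n → (∀ k → k ≤ n → f k ≡ 0) → conv f g n ≡ 0
conv-vanish f g n h = ∑-zero (suc n) (λ k k≤n → cong (_* g (n ∸ k)) (h k (s≤s⁻¹ k≤n)))

conv-shift : ∀ f g b m → conv f g (m + b) ≡
  ∑ b (λ k → f k * g (m + b ∸ k)) + conv (λ k → f (b + k)) g m
conv-shift f g b m = begin
  conv f g (m + b)
    ≡⟨ cong (λ i → ∑ i (λ k → f k * g (m + b ∸ k))) (+-comm (suc m) b) ⟩
  ∑ (b + suc m) (λ k → f k * g (m + b ∸ k))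
    ≡⟨ ∑-split b (suc m) (λ k → f k * g (m + b ∸ k)) ⟩
  ∑ b (λ k → f k * g (m + b ∸ k)) + ∑ (suc m) (λ k → f (b + k) * g (m + b ∸ (b + k)))
    ≡⟨ cong (∑ b (λ k → f k * g (m + b ∸ k)) +_) (∑-cong (suc m) (λ k _ → cong (λ i → f (b + k) * g i)
         (trans (cong (_∸ (b + k)) (+-comm m b)) ([m+n]∸[m+o]≡n∸o b m k)))) ⟩
  ∑ b (λ k → f k * g (m + b ∸ k)) + conv (λ k → f (b + k)) g m ∎
  where open ≡-Reasoning

-- Convolution is linear in its second factor, so it inherits `F-rec`. In the last `suc b` terms the
-- argument is below `suc b`, where `F (suc b)` and `F b` agree.
conv-F : ∀ f b m → conv f (F (suc b)) (m + suc b) ≡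
  conv f (F b) (m + suc b) + (conv f (F b) m + conv f (F (suc b)) m)
conv-F f b m = begin
  conv f (F (suc b)) (m + suc b)
    ≡⟨ ∑-split (suc m) (suc b) (term (F (suc b))) ⟩
  ∑ (suc m) (term (F (suc b))) + ∑ (suc b) (λ i → term (F (suc b)) (suc m + i))
    ≡⟨ cong₂ _+_ (trans (∑-cong (suc m) near) (trans (∑-distrib-+ (suc m) (term (F b)) (λ k → f k * F b (m ∸ k) + f k * F (suc b) (m ∸ k)))
         (cong (∑ (suc m) (term (F b)) +_)
           (∑-distrib-+ (suc m) (λ k → f k * F b (m ∸ k)) (λ k → f k * F (suc b) (m ∸ k))))))
         (∑-cong (suc b) (λ i _ → cong (f (suc m + i) *_) (F-small b _ (far i)))) ⟩
  ∑ (suc m) (term (F b)) + (conv f (F b) m + conv f (F (suc b)) m) +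
  ∑ (suc b) (λ i → term (F b) (suc m + i))
    ≡⟨ swap (∑ (suc m) (term (F b))) (conv f (F b) m + conv f (F (suc b)) m) _ ⟩
  ∑ (suc m) (term (F b)) + ∑ (suc b) (λ i → term (F b) (suc m + i)) +
  (conv f (F b) m + conv f (F (suc b)) m)
    ≡⟨ cong (_+ (conv f (F b) m + conv f (F (suc b)) m)) (∑-split (suc m) (suc b) (term (F b))) ⟨
  conv f (F b) (m + suc b) + (conv f (F b) m + conv f (F (suc b)) m) ∎
  where
  open ≡-Reasoning
  term : (ℕ → ℕ) → ℕ → ℕ
  term g k = f k * g (m + suc b ∸ k)
  swap : ∀ x y z → x + y + z ≡ x + z + y
  swap = solve-∀
  near : ∀ k → k < suc m →
    term (F (suc b)) k ≡ term (F b) k + (f k * F b (m ∸ k) + f k * F (suc b) (m ∸ k))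
  near k k≤m rewrite +-∸-comm (suc b) (s≤s⁻¹ k≤m) | F-rec b (m ∸ k) =
    distrib (f k) (F b (m ∸ k + suc b)) (F b (m ∸ k)) (F (suc b) (m ∸ k))
    where
    distrib : ∀ a x y z → a * (x + (y + z)) ≡ a * x + (a * y + a * z)
    distrib = solve-∀
  far : ∀ i → m + suc b ∸ (suc m + i) < suc b
  far i = s≤s (≤-trans (≤-reflexive (trans (cong (_∸ (suc m + i)) (+-suc m b))
    ([m+n]∸[m+o]≡n∸o (suc m) b i))) (m∸n≤m b i))

-- Coefficients of 2b(qᵇ + q³ᵇ + q⁵ᵇ + …), the logarithmic derivative of (1 + qᵇ)/(1 − qᵇ); here b = suc a.
oddMultiples : ℕ → ℕ → ℕ
oddMultiples a k = if does (k % (2 * suc a) ≟ suc a) then 2 * suc a else 0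

oddMultiples-small : ∀ a k → k < 2 * suc a → k ≢ suc a → oddMultiples a k ≡ 0
oddMultiples-small a k k<2b k≢b =
  if-no (k % (2 * suc a) ≟ suc a) (λ e → k≢b (trans (sym (m<n⇒m%n≡m k<2b)) e))

suc<2* : ∀ a → suc a < 2 * suc a
suc<2* a = m<m+n (suc a) z<s

oddMultiples-first : ∀ a → oddMultiples a (suc a) ≡ 2 * suc a
oddMultiples-first a = if-yes (suc a % (2 * suc a) ≟ suc a) (m<n⇒m%n≡m (suc<2* a))

oddMultiples-periodic : ∀ a k → oddMultiples a (2 * suc a + k) ≡ oddMultiples a k
oddMultiples-periodic a k = cong (λ r → if does (r ≟ suc a) then 2 * suc a else 0)
  (trans (cong (_% (2 * suc a)) (+-comm (2 * suc a) k)) ([m+n]%n≡m%n k (2 * suc a)))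

oddMultiples≤ : ∀ a k → oddMultiples a k ≤ 2 * suc a
oddMultiples≤ a k with k % (2 * suc a) ≟ suc a
... | yes e = ≤-reflexive (if-yes (k % (2 * suc a) ≟ suc a) e)
... | no ¬e = subst (_≤ 2 * suc a) (sym (if-no (k % (2 * suc a) ≟ suc a) ¬e)) z≤n

conv-oddMultiples-small : ∀ a g n → n < suc a → conv (oddMultiples a) g n ≡ 0
conv-oddMultiples-small a g n n<b = conv-vanish (oddMultiples a) g n (λ k k≤n →
  oddMultiples-small a k (<-trans (≤-<-trans k≤n n<b) (suc<2* a)) (<⇒≢ (≤-<-trans k≤n n<b)))

-- Within the first period, which `j ≤ suc a` enforces, the only nonzero coefficient sits at
-- `suc a`; it is reached as soon as `j` is positive.
conv-oddMultiples-window : ∀ a g m j → j ≤ suc a →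
  ∑ (suc a + j) (λ k → oddMultiples a k * g (m + suc a ∸ k)) ≡ (if does (1 ≤? j) then 2 * suc a * g m else 0)
conv-oddMultiples-window a g m j j≤b = trans (∑-split (suc a) j term)
  (cong₂ _+_ (∑-zero (suc a) (λ i i<b → cong (_* g (m + suc a ∸ i))
     (oddMultiples-small a i (<-trans i<b (suc<2* a)) (<⇒≢ i<b)))) (tail j j≤b))
  where
  term : ℕ → ℕ
  term k = oddMultiples a k * g (m + suc a ∸ k)
  tail : ∀ j → j ≤ suc a → ∑ j (λ i → term (suc a + i)) ≡ (if does (1 ≤? j) then 2 * suc a * g m else 0)
  tail zero    _   = refl
  tail (suc j) j<b = trans (cong₂ _+_
    (trans (cong term (+-identityʳ (suc a)))
           (cong₂ _*_ (oddMultiples-first a) (cong g (m+n∸n≡m m (suc a)))))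
    (∑-zero j (λ i i<j → cong (_* g (m + suc a ∸ (suc a + suc i))) (oddMultiples-small a (suc a + suc i)
      (+-monoʳ-< (suc a) (<-≤-trans (s<s i<j) (≤-trans j<b (≤-reflexive (sym (+-identityʳ (suc a)))))))
      (λ e → 1+n≢0 (+-cancelˡ-≡ (suc a) (suc i) 0 (trans e (sym (+-identityʳ (suc a))))))))))
    (+-identityʳ _)

-- With b = `suc a` and L = 2b q^b / (1 - q^(2b)) this reads (1 - q^b) L F_b = b q^b (F_(b-1) +
-- F_b): by F_b = (1 + q^b) / (1 - q^b) · F_(b-1), both sides equal 2b q^b F_(b-1) / (1 - q^b).
conv-oddMultiples : ∀ a m → conv (oddMultiples a) (F (suc a)) (m + suc a) ≡
  suc a * F a m + suc a * F (suc a) m + conv (oddMultiples a) (F (suc a)) m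
conv-oddMultiples a = step-rec a Q base step
  where
  open ≡-Reasoning
  U : ℕ → ℕ
  U = conv (oddMultiples a) (F (suc a))
  Q : ℕ → Set
  Q m = U (m + suc a) ≡ suc a * F a m + suc a * F (suc a) m + U m
  double : ∀ b x → 2 * b * x ≡ b * x + b * x + 0
  double = solve-∀
  base : ∀ n → n < suc a → Q n
  base n n<b = begin
    U (n + suc a)
      ≡⟨ cong (λ i → ∑ i (λ k → oddMultiples a k * F (suc a) (n + suc a ∸ k))) (+-comm (suc n) (suc a)) ⟩
    ∑ (suc a + suc n) (λ k → oddMultiples a k * F (suc a) (n + suc a ∸ k))
      ≡⟨ conv-oddMultiples-window a (F (suc a)) n (suc n) n<b ⟩
    2 * suc a * F (suc a) n
      ≡⟨ double (suc a) (F (suc a) n) ⟩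
    suc a * F (suc a) n + suc a * F (suc a) n + 0
      ≡⟨ cong₂ (λ x y → suc a * x + suc a * F (suc a) n + y) (F-small a n n<b)
               (sym (conv-oddMultiples-small a (F (suc a)) n n<b)) ⟩
    suc a * F a n + suc a * F (suc a) n + U n ∎
  regroup : ∀ b x y z u → 2 * b * (x + (y + z)) + u ≡ b * x + b * (x + (y + z)) + (b * y + b * z + u)
  regroup = solve-∀
  step : ∀ m → Q m → Q (m + suc a)
  step m ih = begin
    U (m + suc a + suc a)
      ≡⟨ cong U (assoc₂ m (suc a)) ⟩
    U (m + 2 * suc a)
      -- The coefficients have period `2 * suc a`: the first period contributes a single term and
      -- the later ones reproduce `U m`.
      ≡⟨ conv-shift (oddMultiples a) (F (suc a)) (2 * suc a) m ⟩
    ∑ (2 * suc a) (λ k → oddMultiples a k * F (suc a) (m + 2 * suc a ∸ k)) +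
    conv (λ k → oddMultiples a (2 * suc a + k)) (F (suc a)) m
      ≡⟨ cong₂ _+_ firstPeriod
           (∑-cong (suc m) (λ k _ → cong (_* F (suc a) (m ∸ k)) (oddMultiples-periodic a k))) ⟩
    2 * suc a * F (suc a) (m + suc a) + U m
      ≡⟨ cong (λ x → 2 * suc a * x + U m) (F-rec a m) ⟩
    2 * suc a * (F a (m + suc a) + (F a m + F (suc a) m)) + U m
      ≡⟨ regroup (suc a) (F a (m + suc a)) (F a m) (F (suc a) m) (U m) ⟩
    suc a * F a (m + suc a) + suc a * (F a (m + suc a) + (F a m + F (suc a) m)) +
    (suc a * F a m + suc a * F (suc a) m + U m)
      ≡⟨ cong₂ (λ x y → suc a * F a (m + suc a) + suc a * x + y) (sym (F-rec a m)) (sym ih) ⟩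
    suc a * F a (m + suc a) + suc a * F (suc a) (m + suc a) + U (m + suc a) ∎
    where
    assoc₂ : ∀ m b → m + b + b ≡ m + 2 * b
    assoc₂ = solve-∀
    firstPeriod : ∑ (2 * suc a) (λ k → oddMultiples a k * F (suc a) (m + 2 * suc a ∸ k)) ≡
                  2 * suc a * F (suc a) (m + suc a)
    firstPeriod = begin
      ∑ (2 * suc a) (λ k → oddMultiples a k * F (suc a) (m + 2 * suc a ∸ k))
        ≡⟨ cong₂ (λ i j → ∑ i (λ k → oddMultiples a k * F (suc a) (j ∸ k)))
                 (cong (suc a +_) (+-identityʳ (suc a))) (sym (assoc₂ m (suc a))) ⟩
      ∑ (suc a + suc a) (λ k → oddMultiples a k * F (suc a) (m + suc a + suc a ∸ k))
        ≡⟨ conv-oddMultiples-window a (F (suc a)) (m + suc a) (suc a) ≤-refl ⟩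
      2 * suc a * F (suc a) (m + suc a) ∎

-- Twice the sum of the divisors j ≤ b of k for which k / j is odd.
S : ℕ → ℕ → ℕ
S zero    k = 0
S (suc a) k = S a k + oddMultiples a k

-- The product rule along `F-rec`: the factor `m + suc a` splits into `m`, which the induction
-- hypotheses handle, and `suc a`, which yields exactly the increment in `conv-oddMultiples`.
F-logDerivative : ∀ b n → n * F b n ≡ conv (S b) (F b) n
F-logDerivative zero    zero    = refl
F-logDerivative zero    (suc n) = trans (*-zeroʳ (suc n)) (sym (conv-vanish (S 0) (F 0) (suc n) (λ _ _ → refl)))
F-logDerivative (suc a) n = step-rec a Q base step n
  where
  open ≡-Reasoning
  Q : ℕ → Set
  Q n = n * F (suc a) n ≡ conv (S (suc a)) (F (suc a)) n
  base : ∀ n → n < suc a → Q n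
  base n n<b = begin
    n * F (suc a) n
      ≡⟨ cong (n *_) (F-small a n n<b) ⟩
    n * F a n
      ≡⟨ F-logDerivative a n ⟩
    conv (S a) (F a) n
      ≡⟨ conv-congʳ (S a) n (λ k k≤n → sym (F-small a k (≤-<-trans k≤n n<b))) ⟩
    conv (S a) (F (suc a)) n
      ≡⟨ +-identityʳ _ ⟨
    conv (S a) (F (suc a)) n + 0
      ≡⟨ cong (conv (S a) (F (suc a)) n +_) (conv-oddMultiples-small a (F (suc a)) n n<b) ⟨
    conv (S a) (F (suc a)) n + conv (oddMultiples a) (F (suc a)) n
      ≡⟨ conv-distribʳ-+ (S a) (oddMultiples a) (F (suc a)) n ⟨
    conv (S (suc a)) (F (suc a)) n ∎
  expand : ∀ m b x y z → (m + b) * (x + (y + z)) ≡ (m + b) * x + (m * y + m * z) + (b * y + b * z)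
  expand = solve-∀
  regroup : ∀ x y z u p q → x + (y + (z + u)) + (p + q) ≡ x + (y + z) + (p + q + u)
  regroup = solve-∀
  step : ∀ m → Q m → Q (m + suc a)
  step m ih = begin
    (m + suc a) * F (suc a) (m + suc a)
      ≡⟨ cong ((m + suc a) *_) (F-rec a m) ⟩
    (m + suc a) * (F a (m + suc a) + (F a m + F (suc a) m))
      ≡⟨ expand m (suc a) (F a (m + suc a)) (F a m) (F (suc a) m) ⟩
    (m + suc a) * F a (m + suc a) + (m * F a m + m * F (suc a) m) + (suc a * F a m + suc a * F (suc a) m)
      ≡⟨ cong (_+ (suc a * F a m + suc a * F (suc a) m)) (cong₂ _+_ (F-logDerivative a (m + suc a))
           (cong₂ _+_ (F-logDerivative a m)
             (trans ih (conv-distribʳ-+ (S a) (oddMultiples a) (F (suc a)) m)))) ⟩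
    conv (S a) (F a) (m + suc a) +
    (conv (S a) (F a) m + (conv (S a) (F (suc a)) m + conv (oddMultiples a) (F (suc a)) m)) +
    (suc a * F a m + suc a * F (suc a) m)
      ≡⟨ regroup (conv (S a) (F a) (m + suc a)) (conv (S a) (F a) m) (conv (S a) (F (suc a)) m)
           (conv (oddMultiples a) (F (suc a)) m) (suc a * F a m) (suc a * F (suc a) m) ⟩
    conv (S a) (F a) (m + suc a) + (conv (S a) (F a) m + conv (S a) (F (suc a)) m) +
    (suc a * F a m + suc a * F (suc a) m + conv (oddMultiples a) (F (suc a)) m)
      ≡⟨ cong₂ _+_ (conv-F (S a) a m) (conv-oddMultiples a m) ⟨
    conv (S a) (F (suc a)) (m + suc a) + conv (oddMultiples a) (F (suc a)) (m + suc a)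
      ≡⟨ conv-distribʳ-+ (S a) (oddMultiples a) (F (suc a)) (m + suc a) ⟨
    conv (S (suc a)) (F (suc a)) (m + suc a) ∎

-- The recurrence for P, its coefficients, and the bound P (n + 1) ≤ 2 P n

s : ℕ → ℕ
s k = S k k

S-stable : ∀ j k → S (j + k) k ≡ s k
S-stable zero    k = refl
S-stable (suc j) k = trans (cong₂ _+_ (S-stable j k)
  (oddMultiples-small (j + k) k (<-trans k<b (suc<2* (j + k))) (<⇒≢ k<b))) (+-identityʳ _)
  where
  k<b : k < suc (j + k)
  k<b = s≤s (m≤n+m k j)

P-logDerivative : ∀ n → n * P n ≡ conv s P n
P-logDerivative n = trans (F-logDerivative n n) (∑-cong (suc n) (λ k k≤n → cong₂ _*_
  (trans (cong (λ i → S i k) (sym (m∸n+n≡m (s≤s⁻¹ k≤n)))) (S-stable (n ∸ k) k))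
  (trans (cong (λ i → F i (n ∸ k)) (sym (m+[n∸m]≡n (s≤s⁻¹ k≤n)))) (E-stable k (n ∸ k) (const 1)))))

S≤ : ∀ b k → S b k ≤ b * suc b
S≤ zero    k = z≤n
S≤ (suc a) k = ≤-trans (+-mono-≤ (S≤ a k) (oddMultiples≤ a k)) (≤-reflexive (next a))
  where
  next : ∀ a → a * suc a + 2 * suc a ≡ suc a * suc (suc a)
  next = solve-∀

-- The divisor `k` of `k` has the odd cofactor 1 and alone contributes `2 * k`.
2k≤s : ∀ k → 2 * k ≤ s k
2k≤s zero    = z≤n
2k≤s (suc k) = ≤-trans (≤-reflexive (sym (oddMultiples-first k))) (m≤n+m _ (S k (suc k)))

P-mono-suc : ∀ n → P n ≤ P (suc n)
P-mono-suc n = ≤-trans (E≤E-suc n n (const 1)) (E-addOne n n (const 1))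

P-mono : ∀ {m n} → m ≤ n → P m ≤ P n
P-mono {m} m≤n = go (≤⇒≤′ m≤n)
  where
  go : ∀ {n} → m ≤′ n → P m ≤ P n
  go ≤′-refl       = ≤-refl
  go (≤′-step {n} m≤n) = ≤-trans (go m≤n) (P-mono-suc n)

F-zero : ∀ b → F b 0 ≡ 1
F-zero zero    = refl
F-zero (suc b) = trans (F-small b 0 z<s) (F-zero b)

F-one : ∀ n → F 1 (suc n) ≡ 2
F-one zero    = refl
F-one (suc n) = trans (cong (F 1) (+-comm 1 (suc n))) (trans (F-rec 0 (suc n))
  (trans (cong (λ i → F 0 i + F 1 (suc n)) (+-comm (suc n) 1)) (F-one n)))

-- The doubling inequality alone does not survive the step to a larger bound: when `suc n` first
-- admits the new part, two overpartitions appear on the left and none on the right. The second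
-- component keeps a reserve of 2 for that moment.
F-double : ∀ a →
  (∀ n → F (suc a) (suc n) ≤ 2 * F (suc a) n) ×
  (∀ n → suc a ≤ n → F (suc a) (suc n) + 2 ≤ 2 * F (suc a) n)
F-double zero = all , large
  where
  all : ∀ n → F 1 (suc n) ≤ 2 * F 1 n
  all zero    = ≤-refl
  all (suc n) rewrite F-one (suc n) | F-one n = s≤s (s≤s z≤n)
  large : ∀ n → 1 ≤ n → F 1 (suc n) + 2 ≤ 2 * F 1 n
  large (suc n) _ rewrite F-one (suc n) | F-one n = ≤-refl
F-double (suc a) = step-rec b Q base step , large
  where
  open ≤-Reasoning
  b = suc a
  ih = proj₁ (F-double a)
  ih₊ = proj₂ (F-double a)
  Q : ℕ → Set
  Q n = F (suc b) (suc n) ≤ 2 * F (suc b) n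
  distrib : ∀ x y z → 2 * x + (2 * y + 2 * z) ≡ 2 * (x + (y + z))
  distrib = solve-∀
  base : ∀ n → n < suc b → Q n
  base n n≤b with m≤n⇒m<n∨m≡n n≤b
  ... | inj₁ n<b = begin
    F (suc b) (suc n)  ≡⟨ F-small b (suc n) n<b ⟩
    F b (suc n)        ≤⟨ ih n ⟩
    2 * F b n          ≡⟨ cong (2 *_) (F-small b n n≤b) ⟨
    2 * F (suc b) n    ∎
  -- Here `suc n` equals the new part: it appears overlined and plain, which the reserve of `ih₊`
  -- pays for.
  ... | inj₂ refl = begin
    F (suc b) (suc b)
      ≡⟨ F-rec b 0 ⟩
    F b (suc b) + (F b 0 + F (suc b) 0)
      ≡⟨ cong (F b (suc b) +_) (cong₂ _+_ (F-zero b) (F-zero (suc b))) ⟩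
    F b (suc b) + 2
      ≤⟨ ih₊ b ≤-refl ⟩
    2 * F b b
      ≡⟨ cong (2 *_) (F-small b b ≤-refl) ⟨
    2 * F (suc b) b ∎
  step : ∀ m → Q m → Q (m + suc b)
  step m q = begin
    F (suc b) (suc m + suc b)
      ≡⟨ F-rec b (suc m) ⟩
    F b (suc m + suc b) + (F b (suc m) + F (suc b) (suc m))
      ≤⟨ +-mono-≤ (ih (m + suc b)) (+-mono-≤ (ih m) q) ⟩
    2 * F b (m + suc b) + (2 * F b m + 2 * F (suc b) m)
      ≡⟨ distrib (F b (m + suc b)) (F b m) (F (suc b) m) ⟩
    2 * (F b (m + suc b) + (F b m + F (suc b) m))
      ≡⟨ cong (2 *_) (F-rec b m) ⟨
    2 * F (suc b) (m + suc b) ∎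
  large : ∀ n → suc b ≤ n → F (suc b) (suc n) + 2 ≤ 2 * F (suc b) n
  large n b<n with below-or-above (suc b) n
  ... | below n<b = contradiction b<n (<⇒≱ n<b)
  ... | above m = begin
    F (suc b) (suc m + suc b) + 2
      ≡⟨ cong (_+ 2) (F-rec b (suc m)) ⟩
    F b (suc m + suc b) + (F b (suc m) + F (suc b) (suc m)) + 2
      ≡⟨ swap (F b (suc m + suc b)) (F b (suc m) + F (suc b) (suc m)) ⟩
    F b (suc m + suc b) + 2 + (F b (suc m) + F (suc b) (suc m))
      ≤⟨ +-mono-≤ (ih₊ (m + suc b) (≤-trans (n≤1+n _) (m≤n+m (suc b) m)))
                  (+-mono-≤ (ih m) (step-rec b Q base step m)) ⟩
    2 * F b (m + suc b) + (2 * F b m + 2 * F (suc b) m)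
      ≡⟨ distrib (F b (m + suc b)) (F b m) (F (suc b) m) ⟩
    2 * (F b (m + suc b) + (F b m + F (suc b) m))
      ≡⟨ cong (2 *_) (F-rec b m) ⟨
    2 * F (suc b) (m + suc b) ∎
    where
    swap : ∀ x y → x + y + 2 ≡ x + 2 + y
    swap = solve-∀

P-double : ∀ n → P (suc n) ≤ 2 * P n
P-double n = begin
  P (suc n)          ≤⟨ proj₁ (F-double n) n ⟩
  2 * F (suc n) n    ≡⟨ cong (2 *_) (F-small n n ≤-refl) ⟩
  2 * P n            ∎
  where open ≤-Reasoning

P-doubles : ∀ k n → P (k + n) ≤ 2 ^ k * P n
P-doubles zero    n = m≤m+n (P n) 0
P-doubles (suc k) n = begin
  P (suc (k + n))       ≤⟨ P-double (k + n) ⟩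
  2 * P (k + n)         ≤⟨ *-monoʳ-≤ 2 (P-doubles k n) ⟩
  2 * (2 ^ k * P n)     ≡⟨ *-assoc 2 (2 ^ k) (P n) ⟨
  2 ^ suc k * P n       ∎
  where open ≤-Reasoning

P-pos : ∀ n → 1 ≤ P n
P-pos n = P-mono {0} {n} z≤n

-- Growth of P

∑-even : ∀ L p → ∑ (suc L) (λ k → 2 * k * p) ≡ L * suc L * p
∑-even zero    p = refl
∑-even (suc L) p = trans (∑-snoc (suc L) (λ k → 2 * k * p))
  (trans (cong (_+ 2 * suc L * p) (∑-even L p)) (next L p))
  where
  next : ∀ L p → L * suc L * p + 2 * suc L * p ≡ suc L * suc (suc L) * p
  next = solve-∀

-- Only the terms `k ≤ L` of the recurrence at `m + L` are kept; in them `s k` is at least `2 * k`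
-- and the value of `P` at least `P m`.
P-growth : ∀ L m → L * suc L * P m ≤ (m + L) * P (m + L)
P-growth L m = begin
  L * suc L * P m
    ≡⟨ ∑-even L (P m) ⟨
  ∑ (suc L) (λ k → 2 * k * P m)
    ≤⟨ ∑-mono-≤ (suc L) (λ k k≤L → *-mono-≤ (2k≤s k)
         (P-mono (≤-trans (m≤m+n m (L ∸ k)) (≤-reflexive (sym (+-∸-assoc m (s≤s⁻¹ k≤L))))))) ⟩
  ∑ (suc L) term
    ≤⟨ m≤m+n _ (∑ m (λ i → term (suc L + i))) ⟩
  ∑ (suc L) term + ∑ m (λ i → term (suc L + i))
    ≡⟨ ∑-split (suc L) m term ⟨
  ∑ (suc L + m) term
    ≡⟨ cong (λ i → ∑ (suc i) term) (+-comm L m) ⟩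
  conv s P (m + L)
    ≡⟨ P-logDerivative (m + L) ⟨
  (m + L) * P (m + L) ∎
  where
  open ≤-Reasoning
  term : ℕ → ℕ
  term k = s k * P (m + L ∸ k)

-- The logarithmic-derivative recurrence of P (y + e), compared term by term with that of P y.
P-shift-step : ∀ K V e y₀ r →
  K * P (y₀ + e) ≤ V * P y₀ →
  (∀ y → y₀ ≤ y → y < r + y₀ → K * P (y + e) ≤ V * P y) →
  let y = r + y₀ ; A = y + e in
  K * (A * P A) ≤ V * (y * P y + P y₀ * ((y₀ + e) * (A * suc A)))
P-shift-step K V e y₀ r h₀ h = begin
  K * (A * P A)
    ≡⟨ cong (K *_) (P-logDerivative A) ⟩
  K * ∑ (suc A) (term A)
    ≡⟨ cong (λ i → K * ∑ (suc i) (term A)) (+-assoc r y₀ e) ⟩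
  K * ∑ (suc r + (y₀ + e)) (term A)
    ≡⟨ cong (K *_) (∑-split (suc r) (y₀ + e) (term A)) ⟩
  K * (∑ (suc r) (term A) + ∑ (y₀ + e) (λ i → term A (suc r + i)))
    ≡⟨ *-distribˡ-+ K _ _ ⟩
  K * ∑ (suc r) (term A) + K * ∑ (y₀ + e) (λ i → term A (suc r + i))
    ≡⟨ cong₂ _+_ (*-distribˡ-∑ (suc r) K (term A))
                 (*-distribˡ-∑ (y₀ + e) K (λ i → term A (suc r + i))) ⟨
  ∑ (suc r) (λ k → K * term A k) + ∑ (y₀ + e) (λ i → K * term A (suc r + i))
    ≤⟨ +-mono-≤ (∑-mono-≤ (suc r) near) (∑-mono-≤ (y₀ + e) far) ⟩
  ∑ (suc r) (λ k → V * term y k) + ∑ (y₀ + e) (const (V * (P y₀ * (A * suc A))))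
    ≡⟨ cong₂ _+_ (*-distribˡ-∑ (suc r) V (term y)) (∑-const (y₀ + e) _) ⟩
  V * ∑ (suc r) (term y) + (y₀ + e) * (V * (P y₀ * (A * suc A)))
    ≤⟨ +-monoˡ-≤ _ (*-monoʳ-≤ V (≤-trans (m≤m+n _ _) (≤-reflexive (sym (∑-split (suc r) y₀ (term y)))))) ⟩
  V * ∑ (suc y) (term y) + (y₀ + e) * (V * (P y₀ * (A * suc A)))
    ≡⟨ cong (λ i → V * i + (y₀ + e) * (V * (P y₀ * (A * suc A)))) (P-logDerivative y) ⟨
  V * (y * P y) + (y₀ + e) * (V * (P y₀ * (A * suc A)))
    ≡⟨ factor V (y * P y) (y₀ + e) (P y₀) (A * suc A) ⟩
  V * (y * P y + P y₀ * ((y₀ + e) * (A * suc A))) ∎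
  where
  open ≤-Reasoning
  y = r + y₀
  A = y + e
  term : ℕ → ℕ → ℕ
  term n k = s k * P (n ∸ k)
  factor : ∀ V a e p A → V * a + e * (V * (p * A)) ≡ V * (a + p * (e * A))
  factor = solve-∀
  swap : ∀ K a p → K * (a * p) ≡ a * (K * p)
  swap = solve-∀
  near : ∀ k → k < suc r → K * term A k ≤ V * term y k
  -- The coefficient `s 0` vanishes, so the claim at `y` itself is never called upon.
  near zero    _   = ≤-reflexive (trans (*-zeroʳ K) (sym (*-zeroʳ V)))
  near (suc k) k<r = begin
    K * (s (suc k) * P (A ∸ suc k))          ≡⟨ swap K (s (suc k)) (P (A ∸ suc k)) ⟩
    s (suc k) * (K * P (A ∸ suc k))          ≡⟨ cong (λ i → s (suc k) * (K * P i)) (+-∸-comm e k<y) ⟩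
    s (suc k) * (K * P (y ∸ suc k + e))      ≤⟨ *-monoʳ-≤ (s (suc k)) (h (y ∸ suc k)
      (≤-trans (m≤n+m y₀ (r ∸ suc k)) (≤-reflexive (sym (+-∸-comm y₀ (s≤s⁻¹ k<r)))))
      (∸-monoʳ-< {y} z<s k<y)) ⟩
    s (suc k) * (V * P (y ∸ suc k))          ≡⟨ swap V (s (suc k)) (P (y ∸ suc k)) ⟨
    V * (s (suc k) * P (y ∸ suc k))          ∎
    where
    k<y : suc k ≤ y
    k<y = ≤-trans (s≤s⁻¹ k<r) (m≤m+n r y₀)
  -- In the remaining terms the argument of `P` has dropped to at most `y₀ + e`, so only the
  -- hypothesis at `y₀` and the crude bound on `s` are used.
  far : ∀ i → i < y₀ + e → K * term A (suc r + i) ≤ V * (P y₀ * (A * suc A))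
  far i i< = begin
    K * (s (suc r + i) * P (A ∸ (suc r + i)))
      ≤⟨ *-monoʳ-≤ K (*-mono-≤ (≤-trans (S≤ (suc r + i) (suc r + i)) (*-mono-≤ k≤A (s≤s k≤A))) (P-mono rest≤)) ⟩
    K * (A * suc A * P (y₀ + e))
      ≡⟨ swap K (A * suc A) (P (y₀ + e)) ⟩
    A * suc A * (K * P (y₀ + e))
      ≤⟨ *-monoʳ-≤ (A * suc A) h₀ ⟩
    A * suc A * (V * P y₀)
      ≡⟨ rotate (A * suc A) V (P y₀) ⟩
    V * (P y₀ * (A * suc A)) ∎
    where
    rotate : ∀ a V p → a * (V * p) ≡ V * (p * a)
    rotate = solve-∀
    k≤A : suc r + i ≤ A
    k≤A = ≤-trans (≤-reflexive (sym (+-suc r i)))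
            (≤-trans (+-monoʳ-≤ r i<) (≤-reflexive (sym (+-assoc r y₀ e))))
    rest≤ : A ∸ (suc r + i) ≤ y₀ + e
    rest≤ = ≤-trans (∸-monoʳ-≤ A (≤-trans (n≤1+n r) (m≤m+n (suc r) i)))
      (≤-reflexive (trans (cong (_∸ r) (+-assoc r y₀ e)) (m+n∸m≡n r (y₀ + e))))

P-shift-close : ∀ K V e y₀ r → 0 < r + y₀ →
  K * P (y₀ + e) ≤ V * P y₀ →
  (∀ y → y₀ ≤ y → y < r + y₀ → K * P (y + e) ≤ V * P y) →
  let y = r + y₀ ; A = y + e in
  P y₀ * ((y₀ + e) * (A * suc A)) ≤ e * P y →
  K * P A ≤ V * P y
P-shift-close K V e y₀ r 0<y h₀ h rem = *-cancelˡ-≤ A {{>-nonZero (≤-trans 0<y (m≤m+n y e))}} (begin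
  A * (K * P A)                                        ≡⟨ swap A K (P A) ⟩
  K * (A * P A)                                        ≤⟨ P-shift-step K V e y₀ r h₀ h ⟩
  V * (y * P y + P y₀ * ((y₀ + e) * (A * suc A)))      ≤⟨ *-monoʳ-≤ V (+-monoʳ-≤ (y * P y) rem) ⟩
  V * (y * P y + e * P y)                              ≡⟨ collect V y e (P y) ⟩
  A * (V * P y)                                        ∎)
  where
  open ≤-Reasoning
  y = r + y₀
  A = y + e
  swap : ∀ a K p → a * (K * p) ≡ K * (a * p)
  swap = solve-∀
  collect : ∀ V y e p → V * (y * p + e * p) ≡ (y + e) * (V * p)
  collect = solve-∀

P-shift : ∀ K V e y₀ y₁ → 0 < y₀ → y₀ < y₁ →
  (∀ y → y₀ ≤ y → y < y₁ → K * P (y + e) ≤ V * P y) →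
  (∀ y → y₁ ≤ y → P y₀ * ((y₀ + e) * ((y + e) * suc (y + e))) ≤ e * P y) →
  ∀ y → y₀ ≤ y → K * P (y + e) ≤ V * P y
P-shift K V e y₀ y₁ 0<y₀ y₀<y₁ base rem = <-rec _ go
  where
  go : ∀ y → (∀ {z} → z < y → y₀ ≤ z → K * P (z + e) ≤ V * P z) → y₀ ≤ y → K * P (y + e) ≤ V * P y
  go y ih y₀≤y with y <? y₁
  ... | yes y<y₁ = base y y₀≤y y<y₁
  ... | no  y≮y₁ with below-or-above y₀ y
  ...   | below y<y₀ = contradiction y₀≤y (<⇒≱ y<y₀)
  ...   | above r = P-shift-close K V e y₀ r (≤-trans 0<y₀ (m≤n+m y₀ r))
                      (base y₀ ≤-refl y₀<y₁) (λ z y₀≤z z<y → ih z<y y₀≤z) (rem (r + y₀) (≮⇒≥ y≮y₁))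

-- For fixed `x` this is the shift argument with `e = x + d` and `V * P x` in place of `V`. It calls
-- on all smaller `z`, also those below `x`, where the roles of the variables are exchanged; hence
-- the induction on the symmetric quantity `x + y`.
P-pairs : ∀ K V d x₀ → 0 < x₀ →
  (∀ x y → x₀ ≤ x → x ≤ y → K * P (y + (x + d)) ≤ V * (P x * P y) ⊎
    (x₀ < y × P x₀ * ((x₀ + (x + d)) * ((y + (x + d)) * suc (y + (x + d)))) ≤ (x + d) * P y)) →
  ∀ x y → x₀ ≤ x → x₀ ≤ y → K * P (y + (x + d)) ≤ V * (P x * P y)
P-pairs K V d x₀ 0<x₀ dich x y x₀≤x x₀≤y = <-rec Q go (x + y) x y refl x₀≤x x₀≤y
  where
  Q : ℕ → Set
  Q n = ∀ x y → x + y ≡ n → x₀ ≤ x → x₀ ≤ y → K * P (y + (x + d)) ≤ V * (P x * P y)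
  ordered : ∀ x y → x ≤ y → x₀ ≤ x →
    (∀ z → x₀ ≤ z → z < y → K * P (z + (x + d)) ≤ V * (P x * P z)) →
    K * P (y + (x + d)) ≤ V * (P x * P y)
  ordered x y x≤y x₀≤x ih with dich x y x₀≤x x≤y
  ... | inj₁ done = done
  ... | inj₂ (x₀<y , rem) with below-or-above x₀ y
  ...   | below y<x₀ = contradiction x₀<y (<-asym y<x₀)
  ...   | above r = subst (K * P (r + x₀ + (x + d)) ≤_) (*-assoc V (P x) (P (r + x₀)))
    (P-shift-close K (V * P x) (x + d) x₀ r (≤-trans 0<x₀ (m≤n+m x₀ r)) (ih′ x₀ ≤-refl x₀<y) ih′ rem)
    where
    ih′ : ∀ z → x₀ ≤ z → z < r + x₀ → K * P (z + (x + d)) ≤ V * P x * P z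
    ih′ z x₀≤z z<y = subst (K * P (z + (x + d)) ≤_) (sym (*-assoc V (P x) (P z))) (ih z x₀≤z z<y)
  swap : ∀ x y d → y + (x + d) ≡ x + (y + d)
  swap = solve-∀
  go : ∀ n → (∀ {k} → k < n → Q k) → Q n
  go n ih x y refl x₀≤x x₀≤y with ≤-total x y
  ... | inj₁ x≤y = ordered x y x≤y x₀≤x
    (λ z x₀≤z z<y → ih (+-monoʳ-< x z<y) x z refl x₀≤x x₀≤z)
  ... | inj₂ y≤x = subst₂ (λ i j → K * P i ≤ V * j) (swap y x d) (*-comm (P y) (P x))
    (ordered y x y≤x x₀≤y (λ z x₀≤z z<x →
      ih (<-≤-trans (+-monoʳ-< y z<x) (≤-reflexive (+-comm y x))) y z refl x₀≤y x₀≤z))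

-- Since `m + 8` is at most a quarter of `t`, the left side is at most (5t/4)² = 25t²/16, which is
-- below 2t².
square-step : ∀ t m → 4 * (m + 8) ≤ t → (t + m + 7) * suc (t + m + 7) ≤ 2 * (t * suc t)
square-step t m h = *-cancelˡ-≤ 16 (begin
  16 * ((t + m + 7) * suc (t + m + 7))
    ≡⟨ left t m ⟩
  (4 * t + (4 * m + 28)) * (4 * t + 4 * (m + 8))
    ≤⟨ *-mono-≤ (+-monoʳ-≤ (4 * t) (≤-trans (≤-trans (m≤m+n _ 4) (≤-reflexive (lessFour m))) h))
                (+-monoʳ-≤ (4 * t) h) ⟩
  (4 * t + t) * (4 * t + t)
    ≤⟨ m≤m+n _ (7 * (t * t) + 32 * t) ⟩
  (4 * t + t) * (4 * t + t) + (7 * (t * t) + 32 * t)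
    ≡⟨ right t ⟩
  16 * (2 * (t * suc t)) ∎)
  where
  open ≤-Reasoning
  left : ∀ t m → 16 * ((t + m + 7) * suc (t + m + 7)) ≡ (4 * t + (4 * m + 28)) * (4 * t + 4 * (m + 8))
  left = solve-∀
  lessFour : ∀ m → 4 * m + 28 + 4 ≡ 4 * (m + 8)
  lessFour = solve-∀
  right : ∀ t → (4 * t + t) * (4 * t + t) + (7 * (t * t) + 32 * t) ≡ 16 * (2 * (t * suc t))
  right = solve-∀

-- `P-growth` with `L = m` gains the factor `suc m` over 8, and `suc m ≥ 16`.
P-eighth : ∀ m → 15 ≤ m → 2 * P (7 * m) ≤ P (8 * m)
P-eighth m@(suc _) 15≤m = *-cancelˡ-≤ 8 (*-cancelˡ-≤ m (begin
  m * (8 * (2 * P (7 * m)))      ≡⟨ assoc m (P (7 * m)) ⟩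
  m * 16 * P (7 * m)             ≤⟨ *-monoˡ-≤ (P (7 * m)) (*-monoʳ-≤ m (s≤s 15≤m)) ⟩
  m * suc m * P (7 * m)          ≤⟨ P-growth m (7 * m) ⟩
  (7 * m + m) * P (7 * m + m)    ≡⟨ cong (λ i → i * P i) (+-comm (7 * m) m) ⟩
  8 * m * P (8 * m)              ≡⟨ rotate m (P (8 * m)) ⟩
  m * (8 * P (8 * m))            ∎))
  where
  open ≤-Reasoning
  assoc : ∀ m p → m * (8 * (2 * p)) ≡ m * 16 * p
  assoc = solve-∀
  rotate : ∀ m p → 8 * m * p ≡ m * (8 * p)
  rotate = solve-∀

-- The factor 8/7 at which the bound propagates is covered by the window [119, 136) = [7·17, 8·17).
P-quadratic : ∀ C D e →
  (∀ y → 119 ≤ y → y < 136 → C * ((y + e) * suc (y + e)) ≤ D * P y) →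
  ∀ y → 119 ≤ y → C * ((y + e) * suc (y + e)) ≤ D * P y
P-quadratic C D e base = <-rec _ go
  where
  open ≤-Reasoning
  go : ∀ y → (∀ {z} → z < y → 119 ≤ z → C * ((z + e) * suc (z + e)) ≤ D * P z) →
    119 ≤ y → C * ((y + e) * suc (y + e)) ≤ D * P y
  go y ih 119≤y with y <? 136
  ... | yes y<136 = base y 119≤y y<136
  ... | no  y≮136 = begin
    C * ((y + e) * suc (y + e))
      ≤⟨ *-monoʳ-≤ C (*-mono-≤ y+e≤ (s≤s y+e≤)) ⟩
    C * ((t + m + 7) * suc (t + m + 7))
      ≤⟨ *-monoʳ-≤ C (square-step t m (≤-trans 4m+32≤7m (m≤m+n (7 * m) e))) ⟩
    C * (2 * (t * suc t))
      ≡⟨ swap C 2 (t * suc t) ⟩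
    2 * (C * (t * suc t))
      ≤⟨ *-monoʳ-≤ 2 (ih 7m<y (*-monoʳ-≤ 7 17≤m)) ⟩
    2 * (D * P (7 * m))
      ≡⟨ swap 2 D (P (7 * m)) ⟩
    D * (2 * P (7 * m))
      ≤⟨ *-monoʳ-≤ D (≤-trans (P-eighth m (≤-trans (m≤m+n 15 2) 17≤m)) (P-mono 8m≤y)) ⟩
    D * P y ∎
    where
    -- As `8 * m ≤ y ≤ 8 * m + 7`, passing from `7 * m` to `y` at most doubles the quadratic by
    -- `square-step` and at least doubles `P` by `P-eighth`.
    m = y / 8
    t = 7 * m + e
    swap : ∀ a b c → a * (b * c) ≡ b * (a * c)
    swap = solve-∀
    17≤m : 17 ≤ m
    17≤m = /-monoˡ-≤ 8 (≮⇒≥ y≮136)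
    8m≤y : 8 * m ≤ y
    8m≤y = ≤-trans (≤-reflexive (*-comm 8 m)) (m/n*n≤m y 8)
    7m<y : 7 * m < y
    7m<y = <-≤-trans (m<n+m (7 * m) (≤-trans (m≤m+n 1 16) 17≤m)) 8m≤y
    4m+32≤7m : 4 * (m + 8) ≤ 7 * m
    4m+32≤7m = begin
      4 * (m + 8)     ≡⟨ expand m ⟩
      4 * m + 32      ≤⟨ +-monoʳ-≤ (4 * m) (≤-trans (m≤m+n 32 19) (*-monoʳ-≤ 3 17≤m)) ⟩
      4 * m + 3 * m   ≡⟨ collect m ⟩
      7 * m           ∎
      where
      expand : ∀ m → 4 * (m + 8) ≡ 4 * m + 32
      expand = solve-∀
      collect : ∀ m → 4 * m + 3 * m ≡ 7 * m
      collect = solve-∀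
    y+e≤ : y + e ≤ t + m + 7
    y+e≤ = begin
      y + e                   ≡⟨ cong (_+ e) (m≡m%n+[m/n]*n y 8) ⟩
      y % 8 + m * 8 + e       ≤⟨ +-monoˡ-≤ e (+-monoˡ-≤ (m * 8) (s≤s⁻¹ (m%n<n y 8))) ⟩
      7 + m * 8 + e           ≡⟨ reorder m e ⟩
      t + m + 7               ∎
      where
      reorder : ∀ m e → 7 + m * 8 + e ≡ 7 * m + e + m + 7
      reorder = solve-∀

-- `P-growth` across the upper half of `y`. One halving gains a factor proportional to `y`, so
-- repeated halving beats any fixed power.
P-half : ∀ y → 1 ≤ y → y * P ⌊ y /2⌋ ≤ 4 * P y
P-half y@(suc k) _ = *-cancelˡ-≤ h (begin
  h * (y * P l)            ≤⟨ *-monoʳ-≤ h (*-monoˡ-≤ (P l) y≤2h) ⟩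
  h * (2 * h * P l)        ≤⟨ m≤m+n _ (2 * h * P l) ⟩
  h * (2 * h * P l) + 2 * h * P l  ≡⟨ regroup h (P l) ⟩
  2 * (h * suc h * P l)    ≤⟨ *-monoʳ-≤ 2 (P-growth h l) ⟩
  2 * ((l + h) * P (l + h)) ≡⟨ cong (λ i → 2 * (i * P i)) (⌊n/2⌋+⌈n/2⌉≡n y) ⟩
  2 * (y * P y)            ≤⟨ *-monoʳ-≤ 2 (*-monoˡ-≤ (P y) y≤2h) ⟩
  2 * (2 * h * P y)        ≡⟨ rotate h (P y) ⟩
  h * (4 * P y)            ∎)
  where
  open ≤-Reasoning
  l = ⌊ y /2⌋
  h = ⌈ y /2⌉
  y≤2h : y ≤ 2 * h
  y≤2h = begin
    y              ≡⟨ ⌊n/2⌋+⌈n/2⌉≡n y ⟨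
    l + h          ≤⟨ +-mono-≤ (⌊n/2⌋≤⌈n/2⌉ y) (m≤m+n h 0) ⟩
    2 * h          ∎
  regroup : ∀ h p → h * (2 * h * p) + 2 * h * p ≡ 2 * (h * suc h * p)
  regroup = solve-∀
  rotate : ∀ h p → 2 * (2 * h * p) ≡ h * (4 * p)
  rotate = solve-∀

power-constant : ℕ → ℕ
power-constant zero    = 1
power-constant (suc t) = 4 * (3 ^ t * power-constant t)

^-distribʳ-* : ∀ m n o → (m * n) ^ o ≡ m ^ o * n ^ o
^-distribʳ-* m n zero    = refl
^-distribʳ-* m n (suc o) = trans (cong (m * n *_) (^-distribʳ-* m n o)) (interchange m n (m ^ o) (n ^ o))
  where
  interchange : ∀ a b c d → a * b * (c * d) ≡ a * c * (b * d)
  interchange = solve-∀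

-- Halving `t` times, which `2 ^ t * x ≤ y` permits without falling below `x`. In `power-constant`
-- each halving costs 4 from `P-half`, and 3 for each remaining power, from `y ≤ 3 * h`.
P-power : ∀ t x → 1 ≤ x → ∀ y → 2 ^ t * x ≤ y → y ^ t * P x ≤ power-constant t * P y
P-power zero    x 1≤x y x≤y = *-monoʳ-≤ 1 (P-mono (≤-trans (m≤m+n x 0) x≤y))
P-power (suc t) x 1≤x y 2x≤y = begin
  y * y ^ t * P x
    ≤⟨ *-monoˡ-≤ (P x) (*-monoʳ-≤ y (^-monoˡ-≤ t y≤3h)) ⟩
  y * (3 * h) ^ t * P x
    ≡⟨ cong (λ i → y * i * P x) (^-distribʳ-* 3 h t) ⟩
  y * (3 ^ t * h ^ t) * P x
    ≡⟨ regroup y (3 ^ t) (h ^ t) (P x) ⟩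
  y * 3 ^ t * (h ^ t * P x)
    ≤⟨ *-monoʳ-≤ (y * 3 ^ t) (P-power t x 1≤x h 2^t≤h) ⟩
  y * 3 ^ t * (power-constant t * P h)
    ≡⟨ regroup₂ y (3 ^ t) (power-constant t) (P h) ⟩
  3 ^ t * power-constant t * (y * P h)
    ≤⟨ *-monoʳ-≤ (3 ^ t * power-constant t) (P-half y (≤-trans (s≤s z≤n) 2≤y)) ⟩
  3 ^ t * power-constant t * (4 * P y)
    ≡⟨ regroup₃ (3 ^ t * power-constant t) (P y) ⟩
  power-constant (suc t) * P y ∎
  where
  open ≤-Reasoning
  h = ⌊ y /2⌋
  regroup : ∀ y a b p → y * (a * b) * p ≡ y * a * (b * p)
  regroup = solve-∀
  regroup₂ : ∀ y a c p → y * a * (c * p) ≡ a * c * (y * p)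
  regroup₂ = solve-∀
  regroup₃ : ∀ a p → a * (4 * p) ≡ 4 * a * p
  regroup₃ = solve-∀
  2^t≤h : 2 ^ t * x ≤ h
  2^t≤h = begin
    2 ^ t * x                        ≡⟨ n≡⌊n+n/2⌋ (2 ^ t * x) ⟩
    ⌊ 2 ^ t * x + 2 ^ t * x /2⌋      ≤⟨ ⌊n/2⌋-mono (≤-trans (≤-reflexive (twice (2 ^ t) x)) 2x≤y) ⟩
    h                                ∎
    where
    twice : ∀ a x → a * x + a * x ≡ 2 * a * x
    twice = solve-∀
  1≤h : 1 ≤ h
  1≤h = ≤-trans (*-mono-≤ (m^n>0 2 t) 1≤x) 2^t≤h
  2≤y : 2 ≤ y
  2≤y = ≤-trans (*-mono-≤ {2} {2 ^ suc t} {1} (*-monoʳ-≤ 2 (m^n>0 2 t)) 1≤x) 2x≤y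
  y≤3h : y ≤ 3 * h
  y≤3h = begin
    y                 ≡⟨ ⌊n/2⌋+⌈n/2⌉≡n y ⟨
    h + ⌈ y /2⌉       ≤⟨ +-monoʳ-≤ h (⌊n/2⌋-mono (n≤1+n (suc y))) ⟩
    h + suc h         ≤⟨ +-monoʳ-≤ h (+-monoˡ-≤ h 1≤h) ⟩
    h + (h + h)       ≡⟨ cong (h +_) (cong (h +_) (+-identityʳ h)) ⟨
    3 * h             ∎

-- Six halvings, hence 64 = 2^6, give `y ^ 6`. Four powers cover the quartic, at most 36 y⁴ and
-- multiplied by 8, which makes 288; the other two beat the constant.
P-quartic : ∀ x y → 1 ≤ x → 64 * x ≤ y → 288 * power-constant 6 ≤ y * y →
  8 * P x * ((2 * y * suc (2 * y)) * (2 * y * suc (2 * y))) ≤ P y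
P-quartic x y 1≤x 64x≤y = go (power-constant 6) (P-power 6 x 1≤x y 64x≤y)
  where
  open ≤-Reasoning
  go : ∀ C → y ^ 6 * P x ≤ C * P y → 288 * C ≤ y * y →
    8 * P x * ((2 * y * suc (2 * y)) * (2 * y * suc (2 * y))) ≤ P y
  go C pow C≤y² with C ≟ 0
  ... | yes refl = contradiction (≤-trans (*-mono-≤ (m^n>0 y {{>-nonZero 1≤y}} 6) (P-pos x)) pow) λ ()
    where
    1≤y : 1 ≤ y
    1≤y = ≤-trans 1≤x (≤-trans (m≤m+n x (63 * x)) 64x≤y)
  ... | no C≢0 = *-cancelˡ-≤ C {{≢-nonZero C≢0}} (begin
    C * (8 * P x * ((2 * y * suc (2 * y)) * (2 * y * suc (2 * y))))
      ≤⟨ *-monoʳ-≤ C (*-monoʳ-≤ (8 * P x) (*-mono-≤ 2y≤ 2y≤)) ⟩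
    C * (8 * P x * ((2 * y * (3 * y)) * (2 * y * (3 * y))))
      ≡⟨ collect C (P x) y ⟩
    288 * C * (y * y * (y * y) * P x)
      ≤⟨ *-monoˡ-≤ (y * y * (y * y) * P x) C≤y² ⟩
    y * y * (y * y * (y * y) * P x)
      ≡⟨ sixth y (P x) ⟩
    y ^ 6 * P x
      ≤⟨ pow ⟩
    C * P y ∎)
    where
    1≤y : 1 ≤ y
    1≤y = ≤-trans 1≤x (≤-trans (m≤m+n x (63 * x)) 64x≤y)
    2y≤ : 2 * y * suc (2 * y) ≤ 2 * y * (3 * y)
    2y≤ = *-monoʳ-≤ (2 * y) (+-monoˡ-≤ (2 * y) 1≤y)
    collect : ∀ C p y → C * (8 * p * ((2 * y * (3 * y)) * (2 * y * (3 * y)))) ≡ 288 * C * (y * y * (y * y) * p)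
    collect = solve-∀
    sixth : ∀ y p → y * y * (y * y * (y * y) * p) ≡ y * (y * (y * (y * (y * (y * 1))))) * p
    sixth = solve-∀

-- For x ≤ y with P x large against P x₀ · y², the recurrence in the smaller variable gains a factor
-- x/(x + y) ≤ 1/2; for larger y the induction on y applies.
P-supermultiplicative-step : ∀ K V x₀ → 1 ≤ x₀ → 288 * power-constant 6 ≤ 64 * x₀ * (64 * x₀) →
  (∀ x y → x₀ ≤ x → x₀ ≤ y → K * P (x + y) ≤ V * (P x * P y)) →
  ∀ x y → 64 * x₀ ≤ x → 64 * x₀ ≤ y → 4 * K * P (x + y) ≤ 3 * V * (P x * P y)
P-supermultiplicative-step K V x₀ 1≤x₀ big hyp u v x₁≤u x₁≤v =
  subst (λ i → 4 * K * P i ≤ 3 * V * (P u * P v))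
    (trans (cong (v +_) (+-identityʳ u)) (+-comm v u))
    (P-pairs (4 * K) (3 * V) 0 x₁ 0<x₁ dich u v x₁≤u x₁≤v)
  where
  open ≤-Reasoning
  x₁ = 64 * x₀
  x₀≤x₁ : x₀ ≤ x₁
  x₀≤x₁ = m≤m+n x₀ (63 * x₀)
  0<x₁ : 0 < x₁
  0<x₁ = ≤-trans 1≤x₀ x₀≤x₁
  quartic : ∀ y → x₁ ≤ y → 8 * P x₀ * ((2 * y * suc (2 * y)) * (2 * y * suc (2 * y))) ≤ P y
  quartic y x₁≤y = P-quartic x₀ y 1≤x₀ x₁≤y (≤-trans big (*-mono-≤ x₁≤y x₁≤y))

  -- The gain: `large` bounds four times the boundary by `A * P x`, and `4 * x ≤ 2 * A` since `x` is
  -- the smaller summand of `A`. Together this is 3 against the 4 on the left.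
  near : ∀ r y → x₀ ≤ y → let x = r + x₀ ; A = x + y in x ≤ y →
    4 * (P x₀ * (A * suc A)) ≤ P x → 4 * K * P A ≤ 3 * V * (P x * P y)
  near r y x₀≤y x≤y large = *-cancelˡ-≤ A {{>-nonZero (≤-trans 1≤x₀ (≤-trans x₀≤y (m≤n+m y x)))}} (begin
    A * (4 * K * P A)
      ≡⟨ reorder A K (P A) ⟩
    4 * (K * (A * P A))
      ≤⟨ *-monoʳ-≤ 4 (P-shift-step K (V * P y) y x₀ r (swapped x₀ ≤-refl) (λ z x₀≤z _ → swapped z x₀≤z)) ⟩
    4 * (V * P y * (x * P x + P x₀ * ((x₀ + y) * (A * suc A))))
      ≡⟨ spread (V * P y) x (P x) (P x₀) (x₀ + y) (A * suc A) ⟩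
    V * P y * (4 * x * P x + (x₀ + y) * (4 * (P x₀ * (A * suc A))))
      ≤⟨ *-monoʳ-≤ (V * P y) (+-mono-≤ (*-monoˡ-≤ (P x) 4x≤2A)
           (*-mono-≤ (+-monoˡ-≤ y (m≤n+m x₀ r)) large)) ⟩
    V * P y * (2 * A * P x + A * P x)
      ≡⟨ gather V (P y) A (P x) ⟩
    A * (3 * V * (P x * P y)) ∎)
    where
    x = r + x₀
    A = x + y
    swapped : ∀ z → x₀ ≤ z → K * P (z + y) ≤ V * P y * P z
    swapped z x₀≤z = ≤-trans (hyp z y x₀≤z x₀≤y)
      (≤-reflexive (trans (cong (V *_) (*-comm (P z) (P y))) (sym (*-assoc V (P y) (P z)))))
    4x≤2A : 4 * x ≤ 2 * A
    4x≤2A = ≤-trans (≤-reflexive (four x)) (*-monoʳ-≤ 2 (+-monoʳ-≤ x x≤y))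
      where
      four : ∀ x → 4 * x ≡ 2 * (x + x)
      four = solve-∀
    reorder : ∀ A K p → A * (4 * K * p) ≡ 4 * (K * (A * p))
    reorder = solve-∀
    spread : ∀ V x p q e B → 4 * (V * (x * p + q * (e * B))) ≡ V * (4 * x * p + e * (4 * (q * B)))
    spread = solve-∀
    gather : ∀ V p A q → V * p * (2 * A * q + A * q) ≡ A * (3 * V * (q * p))
    gather = solve-∀

  double≤ : ∀ {x y} → x ≤ y → x + y ≤ 2 * y
  double≤ {x} {y} x≤y = ≤-trans (+-monoˡ-≤ y x≤y) (≤-reflexive (cong (y +_) (sym (+-identityʳ y))))

  dich : ∀ x y → x₁ ≤ x → x ≤ y → 4 * K * P (y + (x + 0)) ≤ 3 * V * (P x * P y) ⊎
    (x₁ < y × P x₁ * ((x₁ + (x + 0)) * ((y + (x + 0)) * suc (y + (x + 0)))) ≤ (x + 0) * P y)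
  dich x y x₁≤x x≤y rewrite +-identityʳ x | +-comm y x
    with 4 * (P x₀ * ((x + y) * suc (x + y))) ≤? P x | below-or-above x₀ x
  ... | _         | below x<x₀ = contradiction x₀≤x₁ (<⇒≱ (≤-<-trans x₁≤x x<x₀))
  ... | yes large | above r    = inj₁ (near r y (≤-trans x₀≤x₁ (≤-trans x₁≤x x≤y)) x≤y large)
  -- Now `P x` is itself below `4 * (P x₀ * B)`, so the remainder for the induction on `y` is
  -- quadratic in `B`, quartic in `y`, and `quartic` bounds it by `P y`.
  ... | no ¬large | above r    = inj₂ (x₁<y , (begin
    P x₁ * ((x₁ + (r + x₀)) * B)
      ≤⟨ *-mono-≤ (≤-trans (P-mono x₁≤x) (<⇒≤ (≰⇒> ¬large)))
                  (*-monoˡ-≤ B (+-monoˡ-≤ (r + x₀) x₁≤x)) ⟩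
    4 * (P x₀ * B) * ((r + x₀ + (r + x₀)) * B)
      ≡⟨ collect (r + x₀) (P x₀) B ⟩
    (r + x₀) * (8 * P x₀ * (B * B))
      ≤⟨ *-monoʳ-≤ (r + x₀) (≤-trans (*-monoʳ-≤ (8 * P x₀) (*-mono-≤ B≤ B≤)) (quartic y (≤-trans x₁≤x x≤y))) ⟩
    (r + x₀) * P y ∎))
    where
    A = r + x₀ + y
    B = A * suc A
    B≤ : B ≤ 2 * y * suc (2 * y)
    B≤ = *-mono-≤ (double≤ x≤y) (s≤s (double≤ x≤y))
    collect : ∀ x p B → 4 * (p * B) * ((x + x) * B) ≡ x * (8 * p * (B * B))
    collect = solve-∀
    -- Otherwise `y ≤ x₁ ≤ x`, and `quartic` at `x` would make `P x` large.
    x₁<y : x₁ < y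
    x₁<y with x₁ <? y
    ... | yes h = h
    ... | no ¬h = contradiction (begin
      4 * (P x₀ * B)
        ≤⟨ *-monoʳ-≤ 4 (*-monoʳ-≤ (P x₀) (≤-trans B≤ (*-mono-≤ 2y≤2x (s≤s 2y≤2x)))) ⟩
      4 * (P x₀ * Z)
        ≤⟨ m≤m*n _ (2 * Z) {{>-nonZero (≤-trans Z>0 (m≤m+n Z (Z + 0)))}} ⟩
      4 * (P x₀ * Z) * (2 * Z)
        ≡⟨ regroup (P x₀) Z ⟩
      8 * P x₀ * (Z * Z)
        ≤⟨ quartic (r + x₀) x₁≤x ⟩
      P (r + x₀) ∎) ¬large
      where
      Z = 2 * (r + x₀) * suc (2 * (r + x₀))
      2y≤2x : 2 * y ≤ 2 * (r + x₀)
      2y≤2x = *-monoʳ-≤ 2 (≤-trans (≮⇒≥ ¬h) x₁≤x)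
      Z>0 : 0 < Z
      Z>0 = *-mono-≤ (≤-trans (≤-trans 0<x₁ x₁≤x) (m≤m+n (r + x₀) (r + x₀ + 0))) (s≤s (z≤n {2 * (r + x₀)}))
      regroup : ∀ p Z → 4 * (p * Z) * (2 * Z) ≡ 8 * p * (Z * Z)
      regroup = solve-∀

P-supermultiplicative : ∀ x₀ → 1 ≤ x₀ → 288 * power-constant 6 ≤ 64 * x₀ * (64 * x₀) →
  (∀ x y → x₀ ≤ x → x₀ ≤ y → P (x + y) ≤ P x * P y) →
  ∀ m x y → 64 ^ m * x₀ ≤ x → 64 ^ m * x₀ ≤ y → 4 ^ m * P (x + y) ≤ 3 ^ m * (P x * P y)
P-supermultiplicative x₀ 1≤x₀ big hyp zero x y x₀≤x x₀≤y =
  *-monoʳ-≤ 1 (hyp x y (≤-trans (m≤m+n x₀ 0) x₀≤x) (≤-trans (m≤m+n x₀ 0) x₀≤y))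
P-supermultiplicative x₀ 1≤x₀ big hyp (suc m) x y hx hy =
  P-supermultiplicative-step (4 ^ m) (3 ^ m) (64 ^ m * x₀) (≤-trans 1≤x₀ grow)
    (≤-trans big (*-mono-≤ (*-monoʳ-≤ 64 grow) (*-monoʳ-≤ 64 grow)))
    (P-supermultiplicative x₀ 1≤x₀ big hyp m) x y
    (≤-trans (≤-reflexive (sym (*-assoc 64 (64 ^ m) x₀))) hx)
    (≤-trans (≤-reflexive (sym (*-assoc 64 (64 ^ m) x₀))) hy)
  where
  grow : x₀ ≤ 64 ^ m * x₀
  grow = m≤n*m x₀ (64 ^ m) {{m^n≢0 64 m}}

-- Tables

module _ {A : Set} where

  at : A → List A → ℕ → A
  at z []       n       = z
  at z (x ∷ xs) zero    = x
  at z (x ∷ xs) (suc n) = at z xs n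

  at-applyUpTo : ∀ z (f : ℕ → A) l n → n < l → at z (applyUpTo f l) n ≡ f n
  at-applyUpTo z f (suc l) zero    _   = refl
  at-applyUpTo z f (suc l) (suc n) n<l = at-applyUpTo z (f ∘ suc) l n (s<s⁻¹ n<l)

  applyUpTo-cong : ∀ {f g : ℕ → A} l → (∀ i → i < l → f i ≡ g i) → applyUpTo f l ≡ applyUpTo g l
  applyUpTo-cong zero    h = refl
  applyUpTo-cong (suc l) h = cong₂ _∷_ (h 0 z<s) (applyUpTo-cong l (λ i i<l → h (suc i) (s<s i<l)))

  take-applyUpTo : ∀ (f : ℕ → A) {b l} → b ≤ l → take b (applyUpTo f l) ≡ applyUpTo f b
  take-applyUpTo f z≤n       = refl
  take-applyUpTo f (s≤s b≤l) = cong (f 0 ∷_) (take-applyUpTo (f ∘ suc) b≤l)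

  drop-applyUpTo : ∀ (f : ℕ → A) b l → drop b (applyUpTo f l) ≡ applyUpTo (f ∘ (b +_)) (l ∸ b)
  drop-applyUpTo f zero    l       = refl
  drop-applyUpTo f (suc b) zero    = refl
  drop-applyUpTo f (suc b) (suc l) = drop-applyUpTo (f ∘ suc) b l

  ++-applyUpTo : ∀ (f : ℕ → A) k l → applyUpTo f k ++ applyUpTo (f ∘ (k +_)) l ≡ applyUpTo f (k + l)
  ++-applyUpTo f zero    l = refl
  ++-applyUpTo f (suc k) l = cong (f 0 ∷_) (++-applyUpTo (f ∘ suc) k l)

  zipWith-applyUpTo : ∀ (_∙_ : A → A → A) (f g : ℕ → A) k l →
    zipWith _∙_ (applyUpTo f k) (applyUpTo g l) ≡ applyUpTo (λ i → f i ∙ g i) (k ⊓ l)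
  zipWith-applyUpTo _∙_ f g zero    l       = refl
  zipWith-applyUpTo _∙_ f g (suc k) zero    = refl
  zipWith-applyUpTo _∙_ f g (suc k) (suc l) = cong (f 0 ∙ g 0 ∷_) (zipWith-applyUpTo _∙_ (f ∘ suc) (g ∘ suc) k l)

-- The values for all residues at one argument. An added part shifts the residue by one, which
-- becomes a cyclic rotation of the list.
Entry : Set
Entry = List ℕ

_⊕_ : Entry → Entry → Entry
_⊕_ = zipWith _+_

rotate : Entry → Entry
rotate []       = []
rotate (x ∷ xs) = xs ++ x ∷ []

rotates : ℕ → Entry → Entry
rotates zero    xs = xs
rotates (suc k) xs = rotates k (rotate xs)

⊕-applyUpTo : ∀ (f g : ℕ → ℕ) l → applyUpTo f l ⊕ applyUpTo g l ≡ applyUpTo (λ i → f i + g i) l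
⊕-applyUpTo f g l = trans (zipWith-applyUpTo _+_ f g l l) (cong (applyUpTo (λ i → f i + g i)) (⊓-idem l))

rotate-applyUpTo : ∀ d (f : ℕ → ℕ) → (∀ i → f (i + suc d) ≡ f i) →
  rotate (applyUpTo f (suc d)) ≡ applyUpTo (f ∘ suc) (suc d)
rotate-applyUpTo d f periodic =
  trans (cong (λ x → applyUpTo (f ∘ suc) d ++ x ∷ []) (sym (periodic 0))) (applyUpTo-∷ʳ (f ∘ suc) d)

rotates-applyUpTo : ∀ d k (f : ℕ → ℕ) → (∀ i → f (i + suc d) ≡ f i) →
  rotates k (applyUpTo f (suc d)) ≡ applyUpTo (f ∘ (k +_)) (suc d)
rotates-applyUpTo d zero    f periodic = refl
rotates-applyUpTo d (suc k) f periodic =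
  trans (cong (rotates k) (rotate-applyUpTo d f periodic)) (rotates-applyUpTo d k (f ∘ suc) (periodic ∘ suc))

-- A row that satisfies new (b + m) = old (b + m) ⊕ rotate (old m ⊕ new m) refers to itself b places
-- earlier, so it is produced in blocks of length b.
mutual
  blocks : ℕ → ℕ → List Entry → List Entry → List Entry
  blocks zero    b prev rest           = []
  blocks (suc f) b prev []             = []
  blocks (suc f) b prev rest@(_ ∷ _)   = blocks′ f b (zipWith _⊕_ rest prev) rest

  blocks′ : ℕ → ℕ → List Entry → List Entry → List Entry
  blocks′ f b new rest = new ++ blocks f b (map rotate (zipWith _⊕_ rest new)) (drop b rest)

-- Below index `b` the old and the new row agree, so the first carries are rotations of `x ⊕ x`.
nextE : ℕ → ℕ → List Entry → List Entry
nextE l b old = take b old ++ blocks l b (map (λ x → rotate (x ⊕ x)) (take b old)) (drop b old)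

-- This row does not refer to its own new values, so no blocks are needed. The rotation `k` is the
-- residue of `1 + d * b`: the largest part `b` and one more part in `rankClass`.
nextR : ℕ → ℕ → List Entry → List Entry → List Entry → List Entry
nextR b k oldE newE oldR = take b oldR ++ zipWith _⊕_ (drop b oldR) (map (rotates k) (zipWith _⊕_ oldE newE))

entryE : ℕ → ℕ → ℕ → Entry
entryE d b n = applyUpTo (λ i → E b n (λ t → χ d (i + t))) (suc d)

entryR : ℕ → ℕ → ℕ → Entry
entryR d b n = applyUpTo (λ α → R b n (rankClass d α)) (suc d)

mutual
  rows : ℕ → ℕ → ℕ → List Entry × List Entry
  rows d l zero    = applyUpTo (entryE d 0) l , applyUpTo (entryR d 0) l
  rows d l (suc b) = nextRows d l b (rows d l b)

  nextRows : ℕ → ℕ → ℕ → List Entry × List Entry → List Entry × List Entry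
  nextRows d l b (e , r) = nextRows′ d b e (nextE l (suc b) e) r

  nextRows′ : ℕ → ℕ → List Entry → List Entry → List Entry → List Entry × List Entry
  nextRows′ d b e e′ r = e′ , nextR (suc b) ((1 + d * suc b) % suc d) e e′ r

module _ (old new : ℕ → Entry) (b : ℕ)
         (link : ∀ m → new (suc b + m) ≡ old (suc b + m) ⊕ rotate (old m ⊕ new m)) where

  private
    carry : ℕ → Entry
    carry m = rotate (old m ⊕ new m)

  -- `f` is fuel; every block consumes at least one entry, so `l ≤ f` suffices. `k` counts the
  -- entries already produced.
  blocks-correct : ∀ f k l → l ≤ f →
    blocks f (suc b) (applyUpTo (carry ∘ (k +_)) (suc b)) (applyUpTo (λ i → old (suc b + (k + i))) l) ≡
    applyUpTo (λ i → new (suc b + (k + i))) l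
  blocks-correct zero    k zero    _   = refl
  blocks-correct (suc f) k zero    _   = refl
  blocks-correct (suc f) k (suc l) l≤f = begin
    blocks′ f (suc b) (zipWith _⊕_ rest prev) rest
      ≡⟨ cong (λ x → blocks′ f (suc b) x rest) block ⟩
    blocks′ f (suc b) (applyUpTo new′ h) rest
      ≡⟨ cong₂ (λ x y → applyUpTo new′ h ++ blocks f (suc b) x y) carries
               (drop-applyUpTo old′ (suc b) (suc l)) ⟩
    applyUpTo new′ h ++ blocks f (suc b) (applyUpTo (carry ∘ ((suc b + k) +_)) h)
                                         (applyUpTo (old′ ∘ (suc b +_)) (l ∸ b))
      ≡⟨ cong (applyUpTo new′ h ++_) remaining ⟩
    applyUpTo new′ h ++ applyUpTo (new′ ∘ (h +_)) (l ∸ b)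
      ≡⟨ ++-applyUpTo new′ h (l ∸ b) ⟩
    applyUpTo new′ (h + (l ∸ b))
      ≡⟨ cong (applyUpTo new′) (m⊓n+n∸m≡n (suc b) (suc l)) ⟩
    applyUpTo new′ (suc l) ∎
    where
    open ≡-Reasoning
    old′ new′ : ℕ → Entry
    old′ i = old (suc b + (k + i))
    new′ i = new (suc b + (k + i))
    rest prev : List Entry
    rest = applyUpTo old′ (suc l)
    prev = applyUpTo (carry ∘ (k +_)) (suc b)
    h = suc b ⊓ suc l
    block : zipWith _⊕_ rest prev ≡ applyUpTo new′ h
    block = trans (zipWith-applyUpTo _⊕_ old′ (carry ∘ (k +_)) (suc l) (suc b))
      (trans (applyUpTo-cong (suc l ⊓ suc b) (λ i _ → sym (link (k + i))))
             (cong (applyUpTo new′) (⊓-comm (suc l) (suc b))))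
    carries : map rotate (zipWith _⊕_ rest (applyUpTo new′ h)) ≡ applyUpTo (carry ∘ ((suc b + k) +_)) h
    carries = trans (cong (map rotate) (zipWith-applyUpTo _⊕_ old′ new′ (suc l) h))
      (trans (map-applyUpTo (λ i → old′ i ⊕ new′ i) rotate (suc l ⊓ h))
      (trans (cong (applyUpTo (λ i → rotate (old′ i ⊕ new′ i))) (m≥n⇒m⊓n≡n (m⊓n≤n (suc b) (suc l))))
             (applyUpTo-cong h (λ i _ → cong carry (sym (+-assoc (suc b) k i))))))
    shifted : ∀ i → k + (suc b + i) ≡ (suc b + k) + i
    shifted i = trans (sym (+-assoc k (suc b) i)) (cong (_+ i) (+-comm k (suc b)))
    remaining : blocks f (suc b) (applyUpTo (carry ∘ ((suc b + k) +_)) h)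
                                 (applyUpTo (old′ ∘ (suc b +_)) (l ∸ b)) ≡
                applyUpTo (new′ ∘ (h +_)) (l ∸ b)
    -- Either the block just produced was full and the induction continues, or it was the last one
    -- and nothing remains.
    remaining with ≤-total b l
    ... | inj₁ b≤l rewrite m≤n⇒m⊓n≡m b≤l = begin
      blocks f (suc b) (applyUpTo (carry ∘ ((suc b + k) +_)) (suc b)) (applyUpTo (old′ ∘ (suc b +_)) (l ∸ b))
        ≡⟨ cong (blocks f (suc b) _) (applyUpTo-cong (l ∸ b) (λ i _ → cong (old ∘ (suc b +_)) (shifted i))) ⟩
      blocks f (suc b) (applyUpTo (carry ∘ ((suc b + k) +_)) (suc b))
                       (applyUpTo (λ i → old (suc b + ((suc b + k) + i))) (l ∸ b))
        ≡⟨ blocks-correct f (suc b + k) (l ∸ b) (≤-trans (m∸n≤m l b) (s≤s⁻¹ l≤f)) ⟩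
      applyUpTo (λ i → new (suc b + ((suc b + k) + i))) (l ∸ b)
        ≡⟨ applyUpTo-cong (l ∸ b) (λ i _ → cong (new ∘ (suc b +_)) (sym (shifted i))) ⟩
      applyUpTo (new′ ∘ (suc b +_)) (l ∸ b) ∎
    ... | inj₂ l≤b rewrite m≤n⇒m∸n≡0 l≤b = blocks-[] f
      where
      blocks-[] : ∀ f {b p} → blocks f b p [] ≡ []
      blocks-[] zero    = refl
      blocks-[] (suc f) = refl

  nextE-correct : ∀ l → suc b ≤ l → (∀ n → n < suc b → new n ≡ old n) →
    nextE l (suc b) (applyUpTo old l) ≡ applyUpTo new l
  nextE-correct l b<l small = begin
    take (suc b) (applyUpTo old l) ++
    blocks l (suc b) (map double (take (suc b) (applyUpTo old l))) (drop (suc b) (applyUpTo old l))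
      ≡⟨ cong₂ (λ x y → x ++ blocks l (suc b) (map double x) y)
           (trans (take-applyUpTo old b<l) (applyUpTo-cong (suc b) (λ i i<b → sym (small i i<b))))
           (drop-applyUpTo old (suc b) l) ⟩
    applyUpTo new (suc b) ++
    blocks l (suc b) (map double (applyUpTo new (suc b))) (applyUpTo (old ∘ (suc b +_)) (l ∸ suc b))
      ≡⟨ cong (λ x → applyUpTo new (suc b) ++ blocks l (suc b) x (applyUpTo (old ∘ (suc b +_)) (l ∸ suc b)))
           (trans (map-applyUpTo new double (suc b))
                  (applyUpTo-cong (suc b) (λ i i<b → cong (λ x → rotate (x ⊕ new i)) (small i i<b)))) ⟩
    applyUpTo new (suc b) ++
    blocks l (suc b) (applyUpTo carry (suc b)) (applyUpTo (old ∘ (suc b +_)) (l ∸ suc b))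
      ≡⟨ cong (applyUpTo new (suc b) ++_) (blocks-correct l 0 (l ∸ suc b) (m∸n≤m l (suc b))) ⟩
    applyUpTo new (suc b) ++ applyUpTo (new ∘ (suc b +_)) (l ∸ suc b)
      ≡⟨ ++-applyUpTo new (suc b) (l ∸ suc b) ⟩
    applyUpTo new (suc b + (l ∸ suc b))
      ≡⟨ cong (applyUpTo new) (m+[n∸m]≡n b<l) ⟩
    applyUpTo new l ∎
    where
    open ≡-Reasoning
    double : Entry → Entry
    double x = rotate (x ⊕ x)

  nextR-correct : ∀ l k (oldR newR : ℕ → Entry) → suc b ≤ l → (∀ n → n < suc b → newR n ≡ oldR n) →
    (∀ m → newR (suc b + m) ≡ oldR (suc b + m) ⊕ rotates k (old m ⊕ new m)) →
    nextR (suc b) k (applyUpTo old l) (applyUpTo new l) (applyUpTo oldR l) ≡ applyUpTo newR l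
  nextR-correct l k oldR newR b<l small linkR = begin
    take (suc b) (applyUpTo oldR l) ++
    zipWith _⊕_ (drop (suc b) (applyUpTo oldR l))
                (map (rotates k) (zipWith _⊕_ (applyUpTo old l) (applyUpTo new l)))
      ≡⟨ cong₂ _++_
           (trans (take-applyUpTo oldR b<l) (applyUpTo-cong (suc b) (λ i i<b → sym (small i i<b))))
           (cong₂ (zipWith _⊕_) (drop-applyUpTo oldR (suc b) l)
             (trans (cong (map (rotates k)) (zipWith-applyUpTo _⊕_ old new l l))
                    (map-applyUpTo (λ i → old i ⊕ new i) (rotates k) (l ⊓ l)))) ⟩
    applyUpTo newR (suc b) ++
    zipWith _⊕_ (applyUpTo (oldR ∘ (suc b +_)) (l ∸ suc b))
                (applyUpTo (λ i → rotates k (old i ⊕ new i)) (l ⊓ l))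
      ≡⟨ cong (applyUpTo newR (suc b) ++_) (zipWith-applyUpTo _⊕_ _ _ (l ∸ suc b) (l ⊓ l)) ⟩
    applyUpTo newR (suc b) ++
    applyUpTo (λ i → oldR (suc b + i) ⊕ rotates k (old i ⊕ new i)) ((l ∸ suc b) ⊓ (l ⊓ l))
      ≡⟨ cong (applyUpTo newR (suc b) ++_) (trans
           (applyUpTo-cong _ (λ i _ → sym (linkR i)))
           (cong (applyUpTo (newR ∘ (suc b +_)))
             (trans (cong ((l ∸ suc b) ⊓_) (⊓-idem l)) (m≤n⇒m⊓n≡m (m∸n≤m l (suc b)))))) ⟩
    applyUpTo newR (suc b) ++ applyUpTo (newR ∘ (suc b +_)) (l ∸ suc b)
      ≡⟨ ++-applyUpTo newR (suc b) (l ∸ suc b) ⟩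
    applyUpTo newR (suc b + (l ∸ suc b))
      ≡⟨ cong (applyUpTo newR) (m+[n∸m]≡n b<l) ⟩
    applyUpTo newR l ∎
    where open ≡-Reasoning

-- Correctness of the tables

χ-shift : ∀ d i t → χ d (i + suc d + t) ≡ χ d (i + t)
χ-shift d i t = trans (cong (χ d) (swap i d t)) (χ-periodic d (i + t))
  where
  swap : ∀ i d t → i + suc d + t ≡ i + t + suc d
  swap = solve-∀

χ-mod : ∀ d k α t → χ d (k % suc d + α + t) ≡ χ d (k + α + t)
χ-mod d k α t = begin
  χ d (k % suc d + α + t)
    ≡⟨ multiples (k / suc d) (k % suc d + α + t) ⟨
  χ d (k % suc d + α + t + k / suc d * suc d)
    ≡⟨ cong (χ d) (swap (k % suc d) α t (k / suc d * suc d)) ⟩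
  χ d (k % suc d + k / suc d * suc d + α + t)
    ≡⟨ cong (λ i → χ d (i + α + t)) (m≡m%n+[m/n]*n k (suc d)) ⟨
  χ d (k + α + t) ∎
  where
  open ≡-Reasoning
  swap : ∀ r α t q → r + α + t + q ≡ r + q + α + t
  swap = solve-∀
  multiples : ∀ q i → χ d (i + q * suc d) ≡ χ d i
  multiples zero    i = cong (χ d) (+-identityʳ i)
  multiples (suc q) i = trans (cong (χ d) (trans (cong (i +_) (+-comm (suc d) (q * suc d)))
    (sym (+-assoc i (q * suc d) (suc d))))) (trans (χ-periodic d (i + q * suc d)) (multiples q i))

pair : ℕ → ℕ → ℕ → ℕ → ℕ
pair d b m i = E b m (λ t → χ d (i + t)) + E (suc b) m (λ t → χ d (i + t))

pair-periodic : ∀ d b m i → pair d b m (i + suc d) ≡ pair d b m i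
pair-periodic d b m i = cong₂ _+_ (E-cong b m (χ-shift d i)) (E-cong (suc b) m (χ-shift d i))

entryE-link : ∀ d b m → entryE d (suc b) (suc b + m) ≡
  entryE d b (suc b + m) ⊕ rotate (entryE d b m ⊕ entryE d (suc b) m)
entryE-link d b m = sym (begin
  entryE d b (suc b + m) ⊕ rotate (entryE d b m ⊕ entryE d (suc b) m)
    ≡⟨ cong (λ x → entryE d b (suc b + m) ⊕ rotate x) (⊕-applyUpTo (λ i → E b m (λ t → χ d (i + t))) (λ i → E (suc b) m (λ t → χ d (i + t))) (suc d)) ⟩
  entryE d b (suc b + m) ⊕ rotate (applyUpTo (pair d b m) (suc d))
    ≡⟨ cong (entryE d b (suc b + m) ⊕_) (rotate-applyUpTo d (pair d b m) (pair-periodic d b m)) ⟩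
  entryE d b (suc b + m) ⊕ applyUpTo (pair d b m ∘ suc) (suc d)
    ≡⟨ ⊕-applyUpTo (λ i → E b (suc b + m) (λ t → χ d (i + t))) (pair d b m ∘ suc) (suc d) ⟩
  applyUpTo (λ i → E b (suc b + m) (λ t → χ d (i + t)) + pair d b m (suc i)) (suc d)
    ≡⟨ applyUpTo-cong (suc d) (λ i _ → recurrence i) ⟩
  entryE d (suc b) (suc b + m) ∎)
  where
  open ≡-Reasoning
  recurrence : ∀ i → E b (suc b + m) (λ t → χ d (i + t)) + pair d b m (suc i) ≡
                     E (suc b) (suc b + m) (λ t → χ d (i + t))
  recurrence i = trans
    (cong₂ (λ j x → E b j (λ t → χ d (i + t)) + x) (+-comm (suc b) m) (cong₂ _+_
      (E-cong b m (λ t → cong (χ d) (sym (+-suc i t))))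
      (E-cong (suc b) m (λ t → cong (χ d) (sym (+-suc i t))))))
    (trans (sym (E-rec b m (λ t → χ d (i + t))))
           (cong (λ j → E (suc b) j (λ t → χ d (i + t))) (+-comm m (suc b))))

entryR-link : ∀ d b m → entryR d (suc b) (suc b + m) ≡
  entryR d b (suc b + m) ⊕ rotates ((1 + d * suc b) % suc d) (entryE d b m ⊕ entryE d (suc b) m)
entryR-link d b m = sym (begin
  entryR d b (suc b + m) ⊕ rotates k (entryE d b m ⊕ entryE d (suc b) m)
    ≡⟨ cong (λ x → entryR d b (suc b + m) ⊕ rotates k x) (⊕-applyUpTo (λ i → E b m (λ t → χ d (i + t))) (λ i → E (suc b) m (λ t → χ d (i + t))) (suc d)) ⟩
  entryR d b (suc b + m) ⊕ rotates k (applyUpTo (pair d b m) (suc d))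
    ≡⟨ cong (entryR d b (suc b + m) ⊕_) (rotates-applyUpTo d k (pair d b m) (pair-periodic d b m)) ⟩
  entryR d b (suc b + m) ⊕ applyUpTo (pair d b m ∘ (k +_)) (suc d)
    ≡⟨ ⊕-applyUpTo (λ α → R b (suc b + m) (rankClass d α)) (pair d b m ∘ (k +_)) (suc d) ⟩
  applyUpTo (λ α → R b (suc b + m) (rankClass d α) + pair d b m (k + α)) (suc d)
    ≡⟨ applyUpTo-cong (suc d) (λ α _ → recurrence α) ⟩
  entryR d (suc b) (suc b + m) ∎)
  where
  open ≡-Reasoning
  k = (1 + d * suc b) % suc d
  residue : ∀ α t → χ d (k + α + t) ≡ χ d (α + d * suc b + suc t)
  residue α t = trans (χ-mod d (1 + d * suc b) α t) (cong (χ d) (swap (d * suc b) α t))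
    where
    swap : ∀ x α t → 1 + x + α + t ≡ α + x + suc t
    swap = solve-∀
  recurrence : ∀ α → R b (suc b + m) (rankClass d α) + pair d b m (k + α) ≡
                     R (suc b) (suc b + m) (rankClass d α)
  recurrence α = trans
    (cong₂ (λ j x → R b j (rankClass d α) + x) (+-comm (suc b) m)
      (cong₂ _+_ (E-cong b m (residue α)) (E-cong (suc b) m (residue α))))
    (trans (sym (R-rec b m (rankClass d α)))
           (cong (λ j → R (suc b) j (rankClass d α)) (+-comm m (suc b))))

rows-correct : ∀ d l b → b ≤ l → rows d l b ≡ (applyUpTo (entryE d b) l , applyUpTo (entryR d b) l)
rows-correct d l zero    _   = refl
rows-correct d l (suc b) b<l = begin
  nextRows d l b (rows d l b)
    ≡⟨ cong (nextRows d l b) (rows-correct d l b (<⇒≤ b<l)) ⟩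
  nextRows′ d b (applyUpTo (entryE d b) l) (nextE l (suc b) (applyUpTo (entryE d b) l)) (applyUpTo (entryR d b) l)
    ≡⟨ cong (λ x → nextRows′ d b (applyUpTo (entryE d b) l) x (applyUpTo (entryR d b) l))
         (nextE-correct (entryE d b) (entryE d (suc b)) b (entryE-link d b) l b<l
           (λ n n<b → applyUpTo-cong (suc d) (λ i _ → E-small b n (λ t → χ d (i + t)) n<b))) ⟩
  nextRows′ d b (applyUpTo (entryE d b) l) (applyUpTo (entryE d (suc b)) l) (applyUpTo (entryR d b) l)
    ≡⟨ cong (applyUpTo (entryE d (suc b)) l ,_)
         (nextR-correct (entryE d b) (entryE d (suc b)) b (entryE-link d b) l ((1 + d * suc b) % suc d)
           (entryR d b) (entryR d (suc b)) b<l
           (λ n n<b → applyUpTo-cong (suc d) (λ α _ → R-small b n (rankClass d α) n<b)) (entryR-link d b)) ⟩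
  (applyUpTo (entryE d (suc b)) l , applyUpTo (entryR d (suc b)) l) ∎
  where open ≡-Reasoning

table-N : ℕ → ℕ → List Entry
table-N d l = proj₂ (rows d l l)

table-N-correct : ∀ d l α n → n < l → α ≤ d → at 0 (at [] (table-N d l) n) α ≡ N d α n
table-N-correct d l α n n<l α≤d = begin
  at 0 (at [] (table-N d l) n) α
    ≡⟨ cong (λ x → at 0 (at [] (proj₂ x) n) α) (rows-correct d l l ≤-refl) ⟩
  at 0 (at [] (applyUpTo (entryR d l) l) n) α
    ≡⟨ cong (λ x → at 0 x α) (at-applyUpTo [] (entryR d l) l n n<l) ⟩
  at 0 (entryR d l n) α
    ≡⟨ at-applyUpTo 0 (λ α → R l n (rankClass d α)) (suc d) α (s≤s α≤d) ⟩
  R l n (rankClass d α)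
    ≡⟨ cong (λ i → R i n (rankClass d α)) (sym (m∸n+n≡m (<⇒≤ n<l))) ⟩
  R (l ∸ n + n) n (rankClass d α)
    ≡⟨ R-stable (l ∸ n) n (rankClass d α) ⟩
  N d α n ∎
  where open ≡-Reasoning

-- Modulus 1: the divisibility condition always holds, so the single component of each `E` entry
-- counts all overpartitions.
table-P : ℕ → List ℕ
table-P l = map (λ x → at 0 x 0) (proj₁ (rows 0 l l))

table-P-correct : ∀ l n → n < l → at 0 (table-P l) n ≡ P n
table-P-correct l n n<l = begin
  at 0 (table-P l) n
    ≡⟨ cong (λ x → at 0 (map (λ y → at 0 y 0) (proj₁ x)) n) (rows-correct 0 l l ≤-refl) ⟩
  at 0 (map (λ y → at 0 y 0) (applyUpTo (entryE 0 l) l)) n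
    ≡⟨ cong (λ x → at 0 x n) (map-applyUpTo (entryE 0 l) (λ y → at 0 y 0) l) ⟩
  at 0 (applyUpTo (λ n → E l n (λ t → χ 0 t)) l) n
    ≡⟨ at-applyUpTo 0 (λ n → E l n (χ 0)) l n n<l ⟩
  E l n (χ 0)
    ≡⟨ E-cong l n (λ t → if-yes (1 ℕD.∣? t) (ℕD.1∣ t)) ⟩
  F l n
    ≡⟨ cong (λ i → F i n) (sym (m∸n+n≡m (<⇒≤ n<l))) ⟩
  F (l ∸ n + n) n
    ≡⟨ E-stable (l ∸ n) n (const 1) ⟩
  P n ∎
  where open ≡-Reasoning

-- Finite checks and their soundness

allBelow : ℕ → (ℕ → Bool) → Bool
allBelow zero    p = true
allBelow (suc n) p = p n ∧ allBelow n p

∧-sound : ∀ {x y} → T (x ∧ y) → T x × T y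
∧-sound = Equivalence.to T-∧

allBelow-sound : ∀ n p → T (allBelow n p) → ∀ i → i < n → T (p i)
allBelow-sound (suc n) p h i i≤n with m≤n⇒m<n∨m≡n (s≤s⁻¹ i≤n) | ∧-sound {p n} h
... | inj₁ i<n  | _ , rest = allBelow-sound n p rest i i<n
... | inj₂ refl | last , _ = last

between : ℕ → ℕ → (ℕ → Bool) → Bool
between lo hi p = allBelow (hi ∸ lo) (λ i → p (lo + i))

between-sound : ∀ lo hi p → T (between lo hi p) → ∀ x → lo ≤ x → x < hi → T (p x)
between-sound lo hi p h x lo≤x x<hi = subst (T ∘ p) (m+[n∸m]≡n lo≤x)
  (allBelow-sound (hi ∸ lo) (λ i → p (lo + i)) h (x ∸ lo) (∸-monoˡ-< x<hi lo≤x))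

-- The shift 12 is 4 for the upper bound on the class count of the sum and 4 for each of the two
-- lower bounds; the factor 6 exceeds every `c ≤ 5`.
pairTest : List ℕ → ℕ → ℕ → Bool
pairTest t x y = 6 * at 0 t (y + (x + 12)) ≤ᵇ at 0 t x * at 0 t y

pairsTest : List ℕ → ℕ → Bool
pairsTest t x = between x 119 (pairTest t x)

growthTest : List ℕ → ℕ → ℕ → ℕ → ℕ → Bool
growthTest t C D e y = C * ((y + e) * suc (y + e)) ≤ᵇ D * at 0 t y

shiftTest : List ℕ → ℕ → ℕ → ℕ → Bool
shiftTest t V e y = at 0 t (y + e) ≤ᵇ V * at 0 t y

pairsCheck : List ℕ → ℕ → Bool
pairsCheck t x₀ = between x₀ 119 (pairsTest t)

growthCheck : List ℕ → ℕ → ℕ → ℕ → Bool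
growthCheck t C D e = between 119 136 (growthTest t C D e)

-- The second conjunct, extended by `P-quadratic` to all `y ≥ 119`, is the remainder condition of
-- `P-shift`.
shiftCheck : List ℕ → ℕ → ℕ → ℕ → Bool
shiftCheck t V e y₀ = between y₀ 119 (shiftTest t V e) ∧ growthCheck t (at 0 t y₀ * (y₀ + e)) e e

module _ (t : List ℕ) (t-correct : ∀ n → n < 250 → at 0 t n ≡ P n) where

  growthCheck-sound : ∀ C D e → T (growthCheck t C D e) →
    ∀ y → 119 ≤ y → C * ((y + e) * suc (y + e)) ≤ D * P y
  growthCheck-sound C D e h = P-quadratic C D e (λ y 119≤y y<136 →
    subst (λ p → C * ((y + e) * suc (y + e)) ≤ D * p)
      (t-correct y (<-≤-trans y<136 (m≤m+n 136 114)))
      (≤ᵇ⇒≤ _ _ (between-sound 119 136 (growthTest t C D e) h y 119≤y y<136)))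

  -- The bound 131 = 250 - 119 keeps `y + e` inside the table for every `y < 119`.
  shiftCheck-sound : ∀ V e y₀ → 0 < y₀ → y₀ < 119 → e ≤ 131 → T (shiftCheck t V e y₀) →
    ∀ y → y₀ ≤ y → 1 * P (y + e) ≤ V * P y
  shiftCheck-sound V e y₀ 0<y₀ y₀<119 e≤131 h = P-shift 1 V e y₀ 119 0<y₀ y₀<119 base rem
    where
    checks : T (between y₀ 119 (shiftTest t V e)) × T (growthCheck t (at 0 t y₀ * (y₀ + e)) e e)
    checks = ∧-sound h
    base : ∀ y → y₀ ≤ y → y < 119 → 1 * P (y + e) ≤ V * P y
    base y y₀≤y y<119 = ≤-trans (≤-reflexive (*-identityˡ (P (y + e))))
      (subst₂ (λ p q → p ≤ V * q)
        (t-correct (y + e) (+-mono-<-≤ y<119 e≤131))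
        (t-correct y (<-≤-trans y<119 (m≤m+n 119 131)))
        (≤ᵇ⇒≤ _ _ (between-sound y₀ 119 (shiftTest t V e) (proj₁ checks) y y₀≤y y<119)))
    rem : ∀ y → 119 ≤ y → P y₀ * ((y₀ + e) * ((y + e) * suc (y + e))) ≤ e * P y
    rem y 119≤y = ≤-trans
      (≤-reflexive (trans (sym (*-assoc (P y₀) (y₀ + e) ((y + e) * suc (y + e))))
        (cong (λ p → p * (y₀ + e) * ((y + e) * suc (y + e)))
              (sym (t-correct y₀ (<-≤-trans y₀<119 (m≤m+n 119 131)))))))
      (growthCheck-sound (at 0 t y₀ * (y₀ + e)) e e (proj₂ checks) y 119≤y)

  -- From `y = 119` on the remainder condition of `P-pairs` holds uniformly in `x ≤ y`:
  -- `y + (x + 12) ≤ 2 * (y + 6)` and `x₀ + (x + 12) ≤ 2 * (x + 12)` give the shift 6 and the factor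
  -- 8 of the growth check.
  pairsCheck-sound : ∀ x₀ → 0 < x₀ → x₀ < 119 → T (pairsCheck t x₀) →
    T (growthCheck t (8 * at 0 t x₀) 1 6) →
    ∀ x y → x₀ ≤ x → x₀ ≤ y → 6 * P (y + (x + 12)) ≤ 1 * (P x * P y)
  pairsCheck-sound x₀ 0<x₀ x₀<119 near far = P-pairs 6 1 12 x₀ 0<x₀ dich
    where
    open ≤-Reasoning
    below-250 : ∀ {n} → n < 119 → n < 250
    below-250 n<119 = <-≤-trans n<119 (m≤m+n 119 131)
    tested : ∀ x y → x₀ ≤ x → x ≤ y → y < 119 → 6 * P (y + (x + 12)) ≤ 1 * (P x * P y)
    tested x y x₀≤x x≤y y<119 = ≤-trans
      (subst₂ (λ p q → 6 * p ≤ q)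
        (t-correct (y + (x + 12)) (+-mono-<-≤ y<119 (+-monoˡ-≤ 12 (<⇒≤ x<119))))
        (cong₂ _*_ (t-correct x (below-250 x<119)) (t-correct y (below-250 y<119)))
        (≤ᵇ⇒≤ _ _ (between-sound x 119 (pairTest t x)
          (between-sound x₀ 119 (pairsTest t) near x x₀≤x x<119) y x≤y y<119)))
      (≤-reflexive (sym (*-identityˡ (P x * P y))))
      where
      x<119 : x < 119
      x<119 = ≤-<-trans x≤y y<119
    A≤ : ∀ x y → x ≤ y → y + (x + 12) ≤ 2 * (y + 6)
    A≤ x y x≤y = ≤-trans (+-monoʳ-≤ y (+-monoˡ-≤ 12 x≤y)) (≤-reflexive (twice y))
      where
      twice : ∀ y → y + (y + 12) ≡ 2 * (y + 6)
      twice = solve-∀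
    even : ∀ z → suc (suc (2 * z)) ≡ 2 * suc z
    even = solve-∀
    collect : ∀ p x z → p * ((x + x) * (2 * z * (2 * suc z))) ≡ x * (8 * p * (z * suc z))
    collect = solve-∀
    growth : ∀ y → 119 ≤ y → 8 * P x₀ * ((y + 6) * suc (y + 6)) ≤ P y
    growth y 119≤y = begin
      8 * P x₀ * ((y + 6) * suc (y + 6))
        ≡⟨ cong (λ p → 8 * p * ((y + 6) * suc (y + 6))) (t-correct x₀ (below-250 x₀<119)) ⟨
      8 * at 0 t x₀ * ((y + 6) * suc (y + 6))
        ≤⟨ growthCheck-sound (8 * at 0 t x₀) 1 6 far y 119≤y ⟩
      1 * P y
        ≡⟨ *-identityˡ (P y) ⟩
      P y ∎
    rem : ∀ x y → x₀ ≤ x → x ≤ y → 119 ≤ y →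
      P x₀ * ((x₀ + (x + 12)) * ((y + (x + 12)) * suc (y + (x + 12)))) ≤ (x + 12) * P y
    rem x y x₀≤x x≤y 119≤y = begin
      P x₀ * ((x₀ + (x + 12)) * ((y + (x + 12)) * suc (y + (x + 12))))
        ≤⟨ *-monoʳ-≤ (P x₀) (*-mono-≤ (+-monoˡ-≤ (x + 12) (≤-trans x₀≤x (m≤m+n x 12)))
             (*-mono-≤ (A≤ x y x≤y)
               (≤-trans (s≤s (A≤ x y x≤y)) (≤-trans (n≤1+n _) (≤-reflexive (even (y + 6))))))) ⟩
      P x₀ * ((x + 12 + (x + 12)) * (2 * (y + 6) * (2 * suc (y + 6))))
        ≡⟨ collect (P x₀) (x + 12) (y + 6) ⟩
      (x + 12) * (8 * P x₀ * ((y + 6) * suc (y + 6)))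
        ≤⟨ *-monoʳ-≤ (x + 12) (growth y 119≤y) ⟩
      (x + 12) * P y ∎
    dich : ∀ x y → x₀ ≤ x → x ≤ y → 6 * P (y + (x + 12)) ≤ 1 * (P x * P y) ⊎
      (x₀ < y × P x₀ * ((x₀ + (x + 12)) * ((y + (x + 12)) * suc (y + (x + 12)))) ≤ (x + 12) * P y)
    dich x y x₀≤x x≤y = Sum.map (tested x y x₀≤x x≤y)
      (λ 119≤y → <-≤-trans x₀<119 119≤y , rem x y x₀≤x x≤y 119≤y) (<-≤-connex y 119)

count : List Entry → ℕ → ℕ → ℕ
count table n α = at 0 (at [] table n) α

productTest : List Entry → ℕ → ℕ → ℕ → Bool
productTest table n α m = count table (n + m) α <ᵇ count table n α * count table m α

-- Products are tested only for `m < 4 + y₀`; from there on `m = 4 + y` with `y ≥ y₀`, and the ratio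
-- bound on `P` takes over.
classTest : List Entry → ℕ → ℕ → ℕ → ℕ → Bool
classTest table n V y₀ α = (V <ᵇ count table n α) ∧ between 9 (4 + y₀) (productTest table n α)

classCheck : List Entry → ℕ → ℕ → ℕ → ℕ → Bool
classCheck table d n V y₀ = allBelow (suc d) (classTest table n V y₀)

classCheck-sound : ∀ l d n V y₀ → n + (4 + y₀) ≤ l → T (classCheck (table-N d l) d n V y₀) →
  ∀ α → α ≤ d → V < N d α n ×
    (∀ m → 9 ≤ m → m < 4 + y₀ → N d α (n + m) < N d α n * N d α m)
classCheck-sound l d n V y₀ fits h α α≤d =
  subst (V <_) (correct n n<l) (<ᵇ⇒< V _ (proj₁ checks)) ,
  (λ m 9≤m m< → subst₂ _<_
    (correct (n + m) (<-≤-trans (+-monoʳ-< n m<) fits))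
    (cong₂ _*_ (correct n n<l) (correct m (<-≤-trans m< (≤-trans (m≤n+m (4 + y₀) n) fits))))
    (<ᵇ⇒< _ _ (between-sound 9 (4 + y₀) (productTest (table-N d l) n α) (proj₂ checks) m 9≤m m<)))
  where
  checks : T (V <ᵇ count (table-N d l) n α) × T (between 9 (4 + y₀) (productTest (table-N d l) n α))
  checks = ∧-sound (allBelow-sound (suc d) (classTest (table-N d l) n V y₀) h α (s≤s α≤d))
  correct : ∀ k → k < l → count (table-N d l) k α ≡ N d α k
  correct k k<l = table-N-correct d l α k k<l α≤d
  n<l : n < l
  n<l = <-≤-trans (m<m+n n z<s) fits

-- For n = 9 + i: a strict lower bound for all N d α n with 2 ≤ d ≤ 4, and a point from which
-- P (y + n + 8) is at most that bound times P y.
bounds starts : List ℕ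
bounds = 29 ∷ 45 ∷ 67 ∷ 99 ∷ 143 ∷ 203 ∷ 293 ∷ 409 ∷ 571 ∷ 787 ∷ 1075 ∷ 1465 ∷ 1977 ∷ 2655 ∷ 3543 ∷
  4703 ∷ 6211 ∷ 8161 ∷ []
starts = 45 ∷ 37 ∷ 33 ∷ 29 ∷ 26 ∷ 24 ∷ 22 ∷ 21 ∷ 19 ∷ 18 ∷ 17 ∷ 17 ∷ 16 ∷ 15 ∷ 15 ∷ 14 ∷ 14 ∷ 13 ∷ []

smallCheck : ℕ → List ℕ → List Entry → List Entry → List Entry → ℕ → ℕ → ℕ → Bool
smallCheck l t t₂ t₃ t₄ n V y₀ =
  (0 <ᵇ y₀) ∧ (y₀ <ᵇ 119) ∧ (n + (4 + y₀) ≤ᵇ l) ∧ shiftCheck t V (8 + n) y₀ ∧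
  classCheck t₂ 2 n V y₀ ∧ classCheck t₃ 3 n V y₀ ∧ classCheck t₄ 4 n V y₀

allSmallChecks : ℕ → List ℕ → List Entry → List Entry → List Entry → Bool
allSmallChecks l t t₂ t₃ t₄ = allBelow 18 (λ i → smallCheck l t t₂ t₃ t₄ (9 + i) (at 0 bounds i) (at 0 starts i))

small-verified : allSmallChecks 60 (table-P 250) (table-N 2 60) (table-N 3 60) (table-N 4 60) ≡ true
small-verified = refl

allPairsChecks : List ℕ → Bool
allPairsChecks t = pairsCheck t 23 ∧ growthCheck t (8 * at 0 t 23) 1 6

pairs-verified : allPairsChecks (table-P 250) ≡ true
pairs-verified = refl

-- The tables are variables with defining equations, so that soundness is argued without evaluating
-- them.
smallCheck-sound : ∀ l t t₂ t₃ t₄ n V y₀ → n ≤ 26 →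
  (∀ k → k < 250 → at 0 t k ≡ P k) → t₂ ≡ table-N 2 l → t₃ ≡ table-N 3 l → t₄ ≡ table-N 4 l →
  T (smallCheck l t t₂ t₃ t₄ n V y₀) →
  ∀ d α → 2 ≤ d → d ≤ 4 → α ≤ d →
  (∀ y → y₀ ≤ y → 1 * P (y + (8 + n)) ≤ V * P y) ×
  V < N d α n × (∀ m → 9 ≤ m → m < 4 + y₀ → N d α (n + m) < N d α n * N d α m)
smallCheck-sound l t _ _ _ n V y₀ n≤26 t-correct refl refl refl h d α 2≤d d≤4 α≤d =
  shiftCheck-sound t t-correct V (8 + n) y₀ (<ᵇ⇒< 0 y₀ (proj₁ h₁)) (<ᵇ⇒< y₀ 119 (proj₁ h₂))
    (≤-trans (+-monoʳ-≤ 8 n≤26) (m≤m+n 34 97)) (proj₁ h₄) ,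
  classes d 2≤d d≤4 α≤d
  where
  h₁ : T (0 <ᵇ y₀) × _
  h₁ = ∧-sound h
  h₂ : T (y₀ <ᵇ 119) × _
  h₂ = ∧-sound (proj₂ h₁)
  h₃ : T (n + (4 + y₀) ≤ᵇ l) × _
  h₃ = ∧-sound (proj₂ h₂)
  h₄ : T (shiftCheck t V (8 + n) y₀) × _
  h₄ = ∧-sound (proj₂ h₃)
  h₅ : T (classCheck (table-N 2 l) 2 n V y₀) × _
  h₅ = ∧-sound (proj₂ h₄)
  h₆ : T (classCheck (table-N 3 l) 3 n V y₀) × T (classCheck (table-N 4 l) 4 n V y₀)
  h₆ = ∧-sound (proj₂ h₅)
  fits : n + (4 + y₀) ≤ l
  fits = ≤ᵇ⇒≤ _ _ (proj₁ h₃)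
  classes : ∀ d → 2 ≤ d → d ≤ 4 → α ≤ d →
    V < N d α n × (∀ m → 9 ≤ m → m < 4 + y₀ → N d α (n + m) < N d α n * N d α m)
  classes 0 () _ _
  classes 1 (s≤s ()) _ _
  classes 2 _ _ α≤d = classCheck-sound l 2 n V y₀ fits (proj₁ h₅) α α≤d
  classes 3 _ _ α≤d = classCheck-sound l 3 n V y₀ fits (proj₁ h₆) α α≤d
  classes 4 _ _ α≤d = classCheck-sound l 4 n V y₀ fits (proj₂ h₆) α α≤d
  classes (suc (suc (suc (suc (suc _))))) _ (s≤s (s≤s (s≤s (s≤s ())))) _

allSmallChecks-sound : ∀ l t t₂ t₃ t₄ →
  (∀ k → k < 250 → at 0 t k ≡ P k) → t₂ ≡ table-N 2 l → t₃ ≡ table-N 3 l → t₄ ≡ table-N 4 l →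
  allSmallChecks l t t₂ t₃ t₄ ≡ true →
  ∀ i → i < 18 → ∀ d α → 2 ≤ d → d ≤ 4 → α ≤ d →
  (∀ y → at 0 starts i ≤ y → 1 * P (y + (8 + (9 + i))) ≤ at 0 bounds i * P y) ×
  at 0 bounds i < N d α (9 + i) ×
  (∀ m → 9 ≤ m → m < 4 + at 0 starts i → N d α (9 + i + m) < N d α (9 + i) * N d α m)
allSmallChecks-sound l t t₂ t₃ t₄ t-correct e₂ e₃ e₄ h i i<18 = smallCheck-sound l t t₂ t₃ t₄
  (9 + i) (at 0 bounds i) (at 0 starts i) (+-monoʳ-≤ 9 (s≤s⁻¹ i<18)) t-correct e₂ e₃ e₄
  (allBelow-sound 18 (λ i → smallCheck l t t₂ t₃ t₄ (9 + i) (at 0 bounds i) (at 0 starts i))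
    (Equivalence.from T-≡ h) i i<18)

small-facts : ∀ i → i < 18 → ∀ d α → 2 ≤ d → d ≤ 4 → α ≤ d →
  (∀ y → at 0 starts i ≤ y → 1 * P (y + (8 + (9 + i))) ≤ at 0 bounds i * P y) ×
  at 0 bounds i < N d α (9 + i) ×
  (∀ m → 9 ≤ m → m < 4 + at 0 starts i → N d α (9 + i + m) < N d α (9 + i) * N d α m)
small-facts = allSmallChecks-sound 60 (table-P 250) (table-N 2 60) (table-N 3 60) (table-N 4 60)
  (table-P-correct 250) refl refl refl small-verified

allPairsChecks-sound : ∀ t → (∀ k → k < 250 → at 0 t k ≡ P k) → allPairsChecks t ≡ true →
  ∀ x y → 23 ≤ x → 23 ≤ y → 6 * P (y + (x + 12)) ≤ 1 * (P x * P y)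
allPairsChecks-sound t t-correct h =
  pairsCheck-sound t t-correct 23 z<s (m≤m+n 24 95) (proj₁ both) (proj₂ both)
  where
  both : T (pairsCheck t 23) × T (growthCheck t (8 * at 0 t 23) 1 6)
  both = ∧-sound (Equivalence.from T-≡ h)

P-pairs-23 : ∀ x y → 23 ≤ x → 23 ≤ y → 6 * P (y + (x + 12)) ≤ 1 * (P x * P y)
P-pairs-23 = allPairsChecks-sound (table-P 250) (table-P-correct 250) pairs-verified

-- The case c ≤ 5

N-periodic′ : ∀ d α n → N (suc d) (2 + (α + d)) n ≡ N (suc d) α n
N-periodic′ d α n = trans (cong (λ i → N (suc d) i n) (shift α d)) (N-periodic (suc d) α n)
  where
  shift : ∀ α d → 2 + (α + d) ≡ α + suc (suc d)
  shift = solve-∀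

-- The sandwich was stated for a central class of the form 2 + β. Every class has this form up to
-- periodicity, since `2 + (α + d)` is `α` plus the modulus `d + 2`.
P≤c*N′ : ∀ d α n → 2 ≤ d → d ≤ 4 → 0 < n → P n ≤ suc d * N d α (4 + n)
P≤c*N′ (suc d) α n 2≤d d≤4 0<n = subst (λ k → P n ≤ suc (suc d) * k) (N-periodic′ d α (4 + n))
  (P≤c*N (suc d) (α + d) n d≤4 0<n)

c*N≤P′ : ∀ d α n → 2 ≤ d → d ≤ 4 → 0 < n → suc d * N d α n ≤ P (4 + n)
c*N≤P′ (suc d) α n 2≤d d≤4 0<n = subst (λ k → suc (suc d) * k ≤ P (4 + n)) (N-periodic′ d α n)
  (c*N≤P (suc d) (α + d) n d≤4 0<n)

-- Only the factor at `4 + y` is replaced by `P`, so a single `c` appears on each side and cancels.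
-- The shift `8 + n` is `n` plus 4 for each of the two passages.
N-beyond : ∀ d α n V y₀ → 2 ≤ d → d ≤ 4 →
  (∀ y → y₀ ≤ y → 1 * P (y + (8 + n)) ≤ V * P y) → V < N d α n →
  ∀ y → 5 ≤ y → y₀ ≤ y → N d α (n + (4 + y)) < N d α n * N d α (4 + y)
N-beyond d α n V y₀ 2≤d d≤4 ratio V<N y 5≤y y₀≤y = *-cancelˡ-< (suc d) _ _ (begin-strict
  suc d * N d α (n + (4 + y))       ≤⟨ c*N≤P′ d α (n + (4 + y)) 2≤d d≤4 (≤-trans (s≤s z≤n) (m≤n+m (4 + y) n)) ⟩
  P (4 + (n + (4 + y)))             ≡⟨ cong P (reorder n y) ⟩
  P (y + (8 + n))                   ≡⟨ *-identityˡ (P (y + (8 + n))) ⟨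
  1 * P (y + (8 + n))               ≤⟨ ratio y y₀≤y ⟩
  V * P y                           <⟨ *-monoˡ-< (P y) {{>-nonZero (P-pos y)}} V<N ⟩
  N d α n * P y                     ≤⟨ *-monoʳ-≤ (N d α n) (P≤c*N′ d α y 2≤d d≤4 (≤-trans (s≤s z≤n) 5≤y)) ⟩
  N d α n * (suc d * N d α (4 + y)) ≡⟨ swap (N d α n) (suc d) (N d α (4 + y)) ⟩
  suc d * (N d α n * N d α (4 + y)) ∎)
  where
  open ≤-Reasoning
  reorder : ∀ n y → 4 + (n + (4 + y)) ≡ y + (8 + n)
  reorder = solve-∀
  swap : ∀ a b c → a * (b * c) ≡ b * (a * c)
  swap = solve-∀

N-bounded : ∀ d α n V y₀ → 2 ≤ d → d ≤ 4 →
  (∀ y → y₀ ≤ y → 1 * P (y + (8 + n)) ≤ V * P y) ×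
  V < N d α n × (∀ m → 9 ≤ m → m < 4 + y₀ → N d α (n + m) < N d α n * N d α m) →
  ∀ m → 9 ≤ m → N d α (n + m) < N d α n * N d α m
N-bounded d α n V y₀ 2≤d d≤4 (ratio , V<N , near) m 9≤m = split (<-≤-connex m (4 + y₀))
  where
  split : m < 4 + y₀ ⊎ 4 + y₀ ≤ m → N d α (n + m) < N d α n * N d α m
  split (inj₁ m<) = near m 9≤m m<
  split (inj₂ m≥) = subst (λ k → N d α (n + k) < N d α n * N d α k)
    (m+[n∸m]≡n (≤-trans (m≤m+n 4 y₀) m≥))
    (N-beyond d α n V y₀ 2≤d d≤4 ratio V<N (m ∸ 4) (∸-monoˡ-≤ 4 9≤m)
      (≤-trans (≤-reflexive (sym (m+n∸m≡n 4 y₀))) (∸-monoˡ-≤ 4 m≥)))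

N-small : ∀ i → i < 18 → ∀ d α → 2 ≤ d → d ≤ 4 → α ≤ d → ∀ m → 9 ≤ m →
  N d α (9 + i + m) < N d α (9 + i) * N d α m
N-small i i<18 d α 2≤d d≤4 α≤d = N-bounded d α (9 + i) (at 0 bounds i) (at 0 starts i) 2≤d d≤4
  (small-facts i i<18 d α 2≤d d≤4 α≤d)

-- Two lower bounds cost `c * c` while the upper bound returns only one `c`; the missing one is
-- covered by 6.
product-bound : ∀ c k q a b p₁ p₂ → c < 6 → 0 < q →
  c * k ≤ q → 6 * q ≤ 1 * (p₁ * p₂) → p₁ ≤ c * a → p₂ ≤ c * b → k < a * b
product-bound c k q a b p₁ p₂ c<6 0<q k≤ q≤ p₁≤ p₂≤ = *-cancelˡ-< (c * c) k (a * b) (begin-strict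
  c * c * k            ≡⟨ *-assoc c c k ⟩
  c * (c * k)          ≤⟨ *-monoʳ-≤ c k≤ ⟩
  c * q                <⟨ *-monoˡ-< q {{>-nonZero 0<q}} c<6 ⟩
  6 * q                ≤⟨ q≤ ⟩
  1 * (p₁ * p₂)        ≡⟨ *-identityˡ (p₁ * p₂) ⟩
  p₁ * p₂              ≤⟨ *-mono-≤ p₁≤ p₂≤ ⟩
  c * a * (c * b)      ≡⟨ interchange c a b ⟩
  c * c * (a * b)      ∎)
  where
  open ≤-Reasoning
  interchange : ∀ c a b → c * a * (c * b) ≡ c * c * (a * b)
  interchange = solve-∀

N-large : ∀ d α x y → 2 ≤ d → d ≤ 4 → 23 ≤ x → 23 ≤ y →
  N d α (4 + x + (4 + y)) < N d α (4 + x) * N d α (4 + y)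
N-large d α x y 2≤d d≤4 23≤x 23≤y =
  product-bound (suc d) (N d α (4 + x + (4 + y))) (P (y + (x + 12))) (N d α (4 + x)) (N d α (4 + y)) (P x) (P y)
    (s≤s (s≤s d≤4)) (P-pos (y + (x + 12)))
    (subst (λ k → suc d * N d α (4 + x + (4 + y)) ≤ P k) (reorder x y) (c*N≤P′ d α (4 + x + (4 + y)) 2≤d d≤4 z<s))
    (P-pairs-23 x y 23≤x 23≤y)
    (P≤c*N′ d α x 2≤d d≤4 (≤-trans (s≤s z≤n) 23≤x))
    (P≤c*N′ d α y 2≤d d≤4 (≤-trans (s≤s z≤n) 23≤y))
  where
  reorder : ∀ x y → 4 + (4 + x + (4 + y)) ≡ y + (x + 12)
  reorder = solve-∀

-- The split at 27 = 23 + 4 is where `N-large` begins; below it lie the 18 tabulated values 9 to 26.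
N-c≤5 : ∀ d α n₁ n₂ → 2 ≤ d → d ≤ 4 → α ≤ d → 9 ≤ n₁ → 9 ≤ n₂ →
  N d α (n₁ + n₂) < N d α n₁ * N d α n₂
N-c≤5 d α n₁ n₂ 2≤d d≤4 α≤d 9≤n₁ 9≤n₂ = split (<-≤-connex n₁ 27) (<-≤-connex n₂ 27)
  where
  small : ∀ n m → 9 ≤ n → 9 ≤ m → n < 27 → N d α (n + m) < N d α n * N d α m
  small n m 9≤n 9≤m n<27 = subst (λ k → N d α (k + m) < N d α k * N d α m) (m+[n∸m]≡n 9≤n)
    (N-small (n ∸ 9) (∸-monoˡ-< n<27 9≤n) d α 2≤d d≤4 α≤d m 9≤m)
  split : n₁ < 27 ⊎ 27 ≤ n₁ → n₂ < 27 ⊎ 27 ≤ n₂ → N d α (n₁ + n₂) < N d α n₁ * N d α n₂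
  split (inj₁ n₁<27) _ = small n₁ n₂ 9≤n₁ 9≤n₂ n₁<27
  split (inj₂ _) (inj₁ n₂<27) = subst₂ (λ i j → N d α i < j) (+-comm n₂ n₁) (*-comm (N d α n₂) (N d α n₁))
    (small n₂ n₁ 9≤n₂ 9≤n₁ n₂<27)
  split (inj₂ 27≤n₁) (inj₂ 27≤n₂) = subst₂ (λ i j → N d α (i + j) < N d α i * N d α j)
    (m+[n∸m]≡n (≤-trans (m≤m+n 4 23) 27≤n₁)) (m+[n∸m]≡n (≤-trans (m≤m+n 4 23) 27≤n₂))
    (N-large d α (n₁ ∸ 4) (n₂ ∸ 4) 2≤d d≤4 (∸-monoˡ-≤ 4 27≤n₁) (∸-monoˡ-≤ 4 27≤n₂))

-- The case c ≥ 6

n<2^n : ∀ n → suc n ≤ 2 ^ n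
n<2^n zero    = ≤-refl
n<2^n (suc n) = ≤-trans (s≤s (n<2^n n))
  (≤-trans (+-monoˡ-≤ (2 ^ n) (m^n>0 2 n)) (≤-reflexive (cong (λ x → 2 ^ n + x) (sym (+-identityʳ (2 ^ n))))))

-- After `12 * c` improvements the gain (4/3)^(12c) exceeds 2^(4c), because 2^4 · 3^12 < 4^12. And
-- 2^(4c) pays for everything: `c * c` for the two class bounds and 2^(2(c+1)) for undoing a shift
-- by `c + 1` in each argument by doubling.
N-c≥6 : ∀ B → 23 ≤ B → 288 * power-constant 6 ≤ 64 * B * (64 * B) → suc B ≤ 2 ^ 144 →
  ∀ d α n₁ n₂ → 5 ≤ d → 2 ^ (96 * suc d) ≤ n₁ → 2 ^ (96 * suc d) ≤ n₂ →
  N d α (n₁ + n₂) < N d α n₁ * N d α n₂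
N-c≥6 B 23≤B big B< d α n₁ n₂ 5≤d large₁ large₂ =
  subst₂ (λ i j → N d α (i + j) < N d α i * N d α j) (recover n₁ large₁) (recover n₂ large₂)
    (main (n₁ ∸ (2 + d)) (n₂ ∸ (2 + d)) (reduced n₁ large₁) (reduced n₂ large₂))
  where
  open ≤-Reasoning
  c = suc d
  m = 12 * c
  -- Here 64^(12c) = 2^(72c). A further copy of it absorbs the shift `2 + d`, and 2^(24c), at least
  -- 2^144 for c ≥ 6, absorbs `suc B`.
  threshold : 64 ^ m * B + (2 + d) ≤ 2 ^ (96 * c)
  threshold = begin
    64 ^ m * B + (2 + d)          ≤⟨ +-monoʳ-≤ (64 ^ m * B) (≤-trans (n<2^n c) (≤-trans (^-monoʳ-≤ 2 (m≤n*m c 72)) (≤-reflexive 2^72c≡64^m))) ⟩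
    64 ^ m * B + 64 ^ m           ≡⟨ trans (+-comm (64 ^ m * B) (64 ^ m)) (sym (*-suc (64 ^ m) B)) ⟩
    64 ^ m * suc B                ≤⟨ *-mono-≤ (≤-reflexive (sym 2^72c≡64^m)) (≤-trans B< (^-monoʳ-≤ 2 (*-monoʳ-≤ 24 (s≤s 5≤d)))) ⟩
    2 ^ (72 * c) * 2 ^ (24 * c)   ≡⟨ ^-distribˡ-+-* 2 (72 * c) (24 * c) ⟨
    2 ^ (72 * c + 24 * c)         ≡⟨ cong (2 ^_) (*-distribʳ-+ c 72 24) ⟨
    2 ^ (96 * c)                  ∎
    where
    2^72c≡64^m : 2 ^ (72 * c) ≡ 64 ^ m
    2^72c≡64^m = trans (cong (2 ^_) (*-assoc 6 12 c)) (sym (^-*-assoc 2 6 m))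
  reduced : ∀ n → 2 ^ (96 * c) ≤ n → 64 ^ m * B ≤ n ∸ (2 + d)
  reduced n large = m+n≤o⇒m≤o∸n (64 ^ m * B) (≤-trans threshold large)
  recover : ∀ n → 2 ^ (96 * c) ≤ n → 2 + d + (n ∸ (2 + d)) ≡ n
  recover n large = m+[n∸m]≡n (≤-trans (m≤n+m (2 + d) (64 ^ m * B)) (≤-trans threshold large))
  supermultiplicative : ∀ x y → B ≤ x → B ≤ y → P (x + y) ≤ P x * P y
  supermultiplicative x y B≤x B≤y = begin
    P (x + y)              ≤⟨ P-mono (≤-trans (≤-reflexive (+-comm x y)) (+-monoʳ-≤ y (m≤m+n x 12))) ⟩
    P (y + (x + 12))       ≤⟨ m≤m+n _ _ ⟩
    6 * P (y + (x + 12))   ≤⟨ P-pairs-23 x y (≤-trans 23≤B B≤x) (≤-trans 23≤B B≤y) ⟩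
    1 * (P x * P y)        ≡⟨ *-identityˡ (P x * P y) ⟩
    P x * P y              ∎
  G = 2 ^ (4 * c)
  c*2^≤ : c * 2 ^ (2 + d) ≤ 2 ^ (2 * c)
  c*2^≤ = begin
    c * 2 ^ (2 + d)        ≤⟨ *-monoˡ-≤ (2 ^ (2 + d)) (n<2^n d) ⟩
    2 ^ d * 2 ^ (2 + d)    ≡⟨ ^-distribˡ-+-* 2 d (2 + d) ⟨
    2 ^ (d + (2 + d))      ≡⟨ cong (2 ^_) (exponent d) ⟩
    2 ^ (2 * c)            ∎
    where
    exponent : ∀ d → d + (2 + d) ≡ 2 * suc d
    exponent = solve-∀
  c²2^≤G : c * c * 2 ^ (2 + d + (2 + d)) ≤ G
  c²2^≤G = begin
    c * c * 2 ^ (2 + d + (2 + d))           ≡⟨ cong (c * c *_) (^-distribˡ-+-* 2 (2 + d) (2 + d)) ⟩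
    c * c * (2 ^ (2 + d) * 2 ^ (2 + d))     ≡⟨ interchange c (2 ^ (2 + d)) ⟩
    c * 2 ^ (2 + d) * (c * 2 ^ (2 + d))     ≤⟨ *-mono-≤ c*2^≤ c*2^≤ ⟩
    2 ^ (2 * c) * 2 ^ (2 * c)               ≡⟨ ^-distribˡ-+-* 2 (2 * c) (2 * c) ⟨
    2 ^ (2 * c + 2 * c)                     ≡⟨ cong (2 ^_) (*-distribʳ-+ c 2 2) ⟨
    G                                       ∎
    where
    interchange : ∀ c a → c * c * (a * a) ≡ c * a * (c * a)
    interchange = solve-∀
  G*3^m<4^m : G * 3 ^ m < 4 ^ m
  G*3^m<4^m = begin-strict
    2 ^ (4 * c) * 3 ^ (12 * c)       ≡⟨ cong₂ _*_ (^-*-assoc 2 4 c) (^-*-assoc 3 12 c) ⟨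
    (2 ^ 4) ^ c * (3 ^ 12) ^ c       ≡⟨ ^-distribʳ-* (2 ^ 4) (3 ^ 12) c ⟨
    (2 ^ 4 * 3 ^ 12) ^ c             <⟨ ^-monoˡ-< c (<ᵇ⇒< (2 ^ 4 * 3 ^ 12) (4 ^ 12) tt) ⟩
    (4 ^ 12) ^ c                     ≡⟨ ^-*-assoc 4 12 c ⟩
    4 ^ m                            ∎
  main : ∀ x y → 64 ^ m * B ≤ x → 64 ^ m * B ≤ y →
    N d α (2 + d + x + (2 + d + y)) < N d α (2 + d + x) * N d α (2 + d + y)
  main x y hx hy = *-cancelˡ-< (4 ^ m * (c * c)) _ _ (begin-strict
    4 ^ m * (c * c) * N d α (2 + d + x + (2 + d + y))
      ≤⟨ *-monoʳ-≤ (4 ^ m * (c * c)) (N≤P d α (2 + d + x + (2 + d + y))) ⟩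
    4 ^ m * (c * c) * P (2 + d + x + (2 + d + y))
      ≡⟨ cong (λ i → 4 ^ m * (c * c) * P i) (reorder (2 + d) x y) ⟩
    4 ^ m * (c * c) * P (2 + d + (2 + d) + (x + y))
      ≤⟨ *-monoʳ-≤ (4 ^ m * (c * c)) (P-doubles (2 + d + (2 + d)) (x + y)) ⟩
    4 ^ m * (c * c) * (2 ^ (2 + d + (2 + d)) * P (x + y))
      ≡⟨ regroup (4 ^ m) (c * c) (2 ^ (2 + d + (2 + d))) (P (x + y)) ⟩
    c * c * 2 ^ (2 + d + (2 + d)) * (4 ^ m * P (x + y))
      ≤⟨ *-mono-≤ c²2^≤G (P-supermultiplicative B (≤-trans (s≤s z≤n) 23≤B) big supermultiplicative m x y hx hy) ⟩
    G * (3 ^ m * (P x * P y))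
      ≡⟨ *-assoc G (3 ^ m) (P x * P y) ⟨
    G * 3 ^ m * (P x * P y)
      <⟨ *-monoˡ-< (P x * P y) {{>-nonZero (*-mono-≤ (P-pos x) (P-pos y))}} G*3^m<4^m ⟩
    4 ^ m * (P x * P y)
      ≤⟨ *-monoʳ-≤ (4 ^ m) (*-mono-≤ (P≤c*N-wide d α x (positive x hx)) (P≤c*N-wide d α y (positive y hy))) ⟩
    4 ^ m * (c * N d α (2 + d + x) * (c * N d α (2 + d + y)))
      ≡⟨ interchange (4 ^ m) c (N d α (2 + d + x)) (N d α (2 + d + y)) ⟩
    4 ^ m * (c * c) * (N d α (2 + d + x) * N d α (2 + d + y)) ∎)
    where
    positive : ∀ z → 64 ^ m * B ≤ z → 0 < z
    positive z h = ≤-trans (*-mono-≤ (m^n>0 64 m) (≤-trans (s≤s z≤n) 23≤B)) h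
    reorder : ∀ e x y → e + x + (e + y) ≡ e + e + (x + y)
    reorder = solve-∀
    regroup : ∀ q c a p → q * c * (a * p) ≡ c * a * (q * p)
    regroup = solve-∀
    interchange : ∀ q c a b → q * (c * a * (c * b)) ≡ q * (c * c) * (a * b)
    interchange = solve-∀

-- A lower bound for the threshold M_c

last≤sum : ∀ (f : ℕ → ℕ) k → f k ≤ sum (map f (upTo (suc k)))
last≤sum f k = begin
  f k                                 ≡⟨ +-identityʳ (f k) ⟨
  sum (f k ∷ [])                      ≤⟨ m≤n+m _ (sum (applyUpTo f k)) ⟩
  sum (applyUpTo f k) + sum (f k ∷ []) ≡⟨ sum-++ (applyUpTo f k) (f k ∷ []) ⟨
  sum (applyUpTo f k ++ f k ∷ [])     ≡⟨ cong sum (applyUpTo-∷ʳ f k) ⟩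
  sum (applyUpTo f (suc k))           ≡⟨ cong sum (map-upTo f (suc k)) ⟨
  sum (map f (upTo (suc k)))          ∎
  where open ≤-Reasoning

n!≤n^n : ∀ n → n ! ≤ n ^ n
n!≤n^n zero    = ≤-refl
n!≤n^n (suc n) = *-monoʳ-≤ (suc n) (≤-trans (n!≤n^n n) (^-monoˡ-≤ n (n≤1+n n)))

-- Only the last Taylor term i = k = 4c² is kept, with the bound π ≤ 4.
threshold-bound : ∀ X q n → 1 ≤ X → 36 ≤ q →
  let A = 16 * q * 1 * (2 * q * 1 + 4) ; k = 4 * q in
  X * sum (map (λ i → A ^ i * 16 ^ (k ∸ i) * Combinatorics._P_ k (k ∸ i)) (upTo (suc k))) ≤ n * 16 ^ k * k ! →
  16 ^ k ≤ n
threshold-bound X q n 1≤X 36≤q h = *-cancelʳ-≤ (16 ^ k) n ((16 * k) ^ k) {{m^n≢0 (16 * k) k {{>-nonZero 0<16k}}}} (begin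
  -- By `k ! ≤ k ^ k` the last term is at least (A / (16k))^k, and for `q ≥ 36` the base is at least
  -- 16.
  16 ^ k * (16 * k) ^ k         ≡⟨ ^-distribʳ-* 16 (16 * k) k ⟨
  (16 * (16 * k)) ^ k           ≤⟨ ^-monoˡ-≤ k 256k≤A ⟩
  A ^ k                         ≡⟨ trans (*-identityʳ (A ^ k * 1)) (*-identityʳ (A ^ k)) ⟨
  A ^ k * 1 * 1                 ≡⟨ cong (λ j → A ^ k * 16 ^ j * Combinatorics._P_ k j) (n∸n≡0 k) ⟨
  term k                        ≤⟨ last≤sum term k ⟩
  sum (map term (upTo (suc k))) ≤⟨ m≤n*m _ X {{>-nonZero 1≤X}} ⟩
  X * sum (map term (upTo (suc k)))  ≤⟨ h ⟩
  n * 16 ^ k * k !              ≤⟨ *-monoʳ-≤ (n * 16 ^ k) (n!≤n^n k) ⟩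
  n * 16 ^ k * k ^ k            ≡⟨ *-assoc n (16 ^ k) (k ^ k) ⟩
  n * (16 ^ k * k ^ k)          ≡⟨ cong (n *_) (^-distribʳ-* 16 k k) ⟨
  n * (16 * k) ^ k              ∎)
  where
  open ≤-Reasoning
  k = 4 * q
  A = 16 * q * 1 * (2 * q * 1 + 4)
  term : ℕ → ℕ
  term i = A ^ i * 16 ^ (k ∸ i) * Combinatorics._P_ k (k ∸ i)
  0<16k : 0 < 16 * k
  0<16k = *-mono-≤ {1} {16} {1} (s≤s z≤n) (≤-trans (s≤s z≤n) (≤-trans 36≤q (m≤n*m q 4)))
  256k≤A : 16 * (16 * k) ≤ A
  256k≤A = begin
    16 * (16 * (4 * q))        ≡⟨ collect q ⟩
    16 * q * 1 * 64            ≤⟨ *-monoʳ-≤ (16 * q * 1) (≤-trans (m≤m+n 64 12) (+-monoˡ-≤ 4 (*-monoˡ-≤ 1 (*-monoʳ-≤ 2 36≤q)))) ⟩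
    A                          ∎
    where
    collect : ∀ q → 16 * (16 * (4 * q)) ≡ 16 * q * 1 * 64
    collect = solve-∀

AtLeastM⇒2^96c≤ : ∀ c n → 6 ≤ c → AtLeastM c n → 2 ^ (96 * c) ≤ n
AtLeastM⇒2^96c≤ c n 6≤c h = begin
  2 ^ (96 * c)          ≡⟨ cong (2 ^_) (exponent c) ⟩
  2 ^ (16 * (c * 6))    ≤⟨ ^-monoʳ-≤ 2 (*-monoʳ-≤ 16 (*-monoʳ-≤ c 6≤c)) ⟩
  2 ^ (16 * (c * c))    ≡⟨ cong (2 ^_) (exponent₂ c) ⟩
  2 ^ (4 * (4 * c ^ 2)) ≡⟨ ^-*-assoc 2 4 (4 * c ^ 2) ⟨
  16 ^ (4 * c ^ 2)      ≤⟨ threshold-bound (1691 * 10 ^ 10 * c ^ 20) (c ^ 2) n X>0 (^-monoˡ-≤ 2 6≤c) (h 0 (4 * c ^ 2)) ⟩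
  n                     ∎
  where
  open ≤-Reasoning
  X>0 : 1 ≤ 1691 * 10 ^ 10 * c ^ 20
  X>0 = *-mono-≤ {1} {1691 * 10 ^ 10} {1} (s≤s z≤n) (m^n>0 c {{>-nonZero (≤-trans (s≤s z≤n) 6≤c)}} 20)
  exponent : ∀ c → 96 * c ≡ 16 * (c * 6)
  exponent = solve-∀
  exponent₂ : ∀ c → 16 * (c * c) ≡ 4 * (4 * (c * (c * 1)))
  exponent₂ = solve-∀

-- Rank classes in terms of N

length-filter : ∀ {Q : OverPartition → Set} (Q? : Decidable Q) xs →
  length (filter Q? xs) ≡ total (λ p → if does (Q? p) then 1 else 0) xs
length-filter Q? []       = refl
length-filter Q? (x ∷ xs) with does (Q? x)
... | true  = cong suc (length-filter Q? xs)
... | false = length-filter Q? xs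

-- With `a = r + q * c`, largest part l and t parts, the sum of `rank p - a` and `K p` is (l - q) ·
-- c; so `c` divides one exactly when it divides the other.
Nbar≡N : ∀ a d n → Nbar a (suc d) n ≡ N d (a ℤ.%ℕ suc d) n
Nbar≡N a d n = trans
  (length-filter (λ p → pos (suc d) ℤD.∣? (rank p ℤ.- a)) (overpartitions n))
  (total-cong (All.universal (λ p → if-iff (pos (suc d) ℤD.∣? (rank p ℤ.- a)) (suc d ℕD.∣? K p)
      (λ h → ℤD.∣⇒∣ᵤ {pos (suc d)} {pos (K p)} (ℤD.∣m+n∣m⇒∣n {pos (suc d)} {rank p ℤ.- a} (multiple p) h))
      (λ h → ℤD.∣m+n∣n⇒∣m {pos (suc d)} {rank p ℤ.- a} (multiple p) (ℤD.∣ᵤ⇒∣ {pos (suc d)} {pos (K p)} h)))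
    (overpartitions n)))
  where
  r = a ℤ.%ℕ suc d
  q = a ℤ./ℕ suc d
  K : OverPartition → ℕ
  K p = r + d * largestPart p + numParts p
  identity : ∀ l t r q d → (l ℤ.- t) ℤ.- (r ℤ.+ q ℤ.* (pos 1 ℤ.+ d)) ℤ.+ (r ℤ.+ d ℤ.* l ℤ.+ t) ≡
    (l ℤ.- q) ℤ.* (pos 1 ℤ.+ d)
  identity = ℤ.solve-∀
  multiple : ∀ p → pos (suc d) ℤD.∣ (rank p ℤ.- a ℤ.+ pos (K p))
  multiple p = ℤD.divides (pos (largestPart p) ℤ.- q) (begin
    rank p ℤ.- a ℤ.+ pos (K p)
      ≡⟨ cong₂ (λ x y → rank p ℤ.- x ℤ.+ y) (ℤ.a≡a%ℕn+[a/ℕn]*n a (suc d))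
           (trans (ℤ.pos-+ (r + d * largestPart p) (numParts p)) (cong (λ x → x ℤ.+ pos (numParts p))
             (trans (ℤ.pos-+ r (d * largestPart p)) (cong (λ x → pos r ℤ.+ x) (ℤ.pos-* d (largestPart p)))))) ⟩
    rank p ℤ.- (pos r ℤ.+ q ℤ.* pos (suc d)) ℤ.+ (pos r ℤ.+ pos d ℤ.* pos (largestPart p) ℤ.+ pos (numParts p))
      ≡⟨ identity (pos (largestPart p)) (pos (numParts p)) (pos r) q (pos d) ⟩
    (pos (largestPart p) ℤ.- q) ℤ.* pos (suc d) ∎)
    where open ≡-Reasoning

theorem1p1 : (c : ℕ) → 3 ≤ c → (a : ℤ) → (n₁ n₂ : ℕ) →
    ((c ≤ 5 × 9 ≤ n₁ × 9 ≤ n₂) ⊎ (6 ≤ c × AtLeastM c n₁ × AtLeastM c n₂)) →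
    Nbar a c (n₁ + n₂) < Nbar a c n₁ * Nbar a c n₂
theorem1p1 (suc d) (s≤s 2≤d) a n₁ n₂ hyp = subst₂ _<_ (sym (Nbar≡N a d (n₁ + n₂)))
  (sym (cong₂ _*_ (Nbar≡N a d n₁) (Nbar≡N a d n₂))) (cases hyp)
  where
  α = a ℤ.%ℕ suc d
  cases : ((suc d ≤ 5 × 9 ≤ n₁ × 9 ≤ n₂) ⊎ (6 ≤ suc d × AtLeastM (suc d) n₁ × AtLeastM (suc d) n₂)) →
    N d α (n₁ + n₂) < N d α n₁ * N d α n₂
  cases (inj₁ (s≤s d≤4 , 9≤n₁ , 9≤n₂)) = N-c≤5 d α n₁ n₂ 2≤d d≤4 (s≤s⁻¹ (ℤ.n%ℕd<d a (suc d))) 9≤n₁ 9≤n₂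
  -- For `B = 2 ^ 18` the square of `64 * B` is 2^48, above `288 * power-constant 6`, which is about
  -- 1.7 · 10^13.
  cases (inj₂ (s≤s 5≤d , large₁ , large₂)) = N-c≥6 (2 ^ 18)
    (≤ᵇ⇒≤ 23 (2 ^ 18) tt) (≤ᵇ⇒≤ (288 * power-constant 6) (64 * 2 ^ 18 * (64 * 2 ^ 18)) tt)
    (≤ᵇ⇒≤ (suc (2 ^ 18)) (2 ^ 144) tt) d α n₁ n₂ 5≤d
    (AtLeastM⇒2^96c≤ (suc d) n₁ (s≤s 5≤d) large₁) (AtLeastM⇒2^96c≤ (suc d) n₂ (s≤s 5≤d) large₂)
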